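{- Let $w$ be an annular web of degree $n$, and let $I$ be a radial cut of $w$ with initial thickness $t(I)$. Then for $1\le k\le n$ the coefficient of the hook Schur function $s_{(k,1^{n-k})}$ in the web LLT function $\mathrm{LLT}_w$ is $$[s_{(k,1^{n-k})}]\mathrm{LLT}_w=\frac1{[t(I)]!}\sum_{\mathcal L\in\mathrm{SLD}(w,I)}\ \sum_{T\in\mathrm{SYT}(k,1^{n-k})}q^{\mathrm{inv}_{\mathcal L}(T)}.$$
   Context: **Annular webs.** Let $\mathbb A=[0,1]\times[0,1]/\big((x,0)\sim(x,1)\big)$ be the annulus; left/right refer to the first coordinate, upward to the second. An annular web $w$ is a finite trivalent graph embedded in $\mathbb A$ (vertex-free essential circles are allowed as edges), all of whose edges are oriented upward (the second coordinate increases along each edge), together with a thickness $t(e)\in\mathbb Z_{>0}$ for each edge $e$, such that at every vertex the total incoming thickness equals the total outgoing thickness. Every vertex is a merge (two incoming edges, one outgoing) or a split (one incoming, two outgoing). The degree $\deg(w)$ is $\sum t(e)$ over the edges crossed by any radial (horizontal) segment transverse to $w$ and avoiding vertices. **Radial cut, labeled loop decompositions.** A radial cut $I$ is a radial (horizontal) segment across $\mathbb A$ transverse to $w$ and disjoint from its vertices. Let $e_1,\dots,e_r$ be the edges meeting $I$, from left to right; the initial thickness is $t(I)=(t(e_1),\dots,t(e_r))$. For a composition $\alpha=(\alpha_1,\dots,\alpha_r)$, $[\alpha]!=[\alpha_1]!\cdots[\alpha_r]!$ with $[k]!=[1]\cdots[k]$ and $[k]=\frac{q^k-q^{ -k}}{q-q^{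 -1}}$. Let $B_j=\{t(e_1)+\cdots+t(e_{j-1})+1,\dots,t(e_1)+\cdots+t(e_j)\}\subset[n]=\{1,\dots,n\}$. A standard labeled loop decomposition of $(w,I)$ is a map $\mathcal L$ from edges of $w$ to subsets of $[n]$ with (1) $\mathcal L(e_j)=B_j$ for all $j$; (2) $|\mathcal L(e)|=t(e)$ for all $e$; (3) at every merge or split, the label set of the single edge on one side is the disjoint union of the label sets of the two edges on the other side. $\mathrm{SLD}(w,I)$ is the set of these. For $u\in[n]$, $L_u$ is the loop formed by the edges whose label set contains $u$. **Web LLT function.** For $\mathcal L\in\mathrm{SLD}(w,I)$, the multiset $\mathsf A_I(\mathcal L)$ of ordered attacking pairs consists of: one pair $(u,v)$ for each block $B_j$ and each $u<v$ in $B_j$; and, for each merge, one pair $(u,v)$ whenever $L_u$ enters the merge from the left and $L_v$ from the right (all counted with multiplicity). For an arbitrary map $\sigma:[n]\to\mathbb Z_{>0}$ put $\epsilon_\sigma(u,v)=+1$ if $\sigma(v)>\sigma(u)$, or $\sigma(v)=\sigma(u)$ and $v<u$; and $\epsilon_\sigma(u,v)=-1$ otherwise. Put $\mathrm{inv}_{\mathcal L}(\sigma)=\sum_{(u,v)\in\mathsf A_I(\mathcal L)}\epsilon_\sigma(u,v)$ and $x^\sigma=\prod_{u=1}^nx_{\sigma(u)}$. The web LLT function of $w$ relative to $I$ is $$\mathrm{LLT}_{w,I}[\mathbf x;q]=\frac1{[t(I)]!}\sum_{\mathcal L\in\mathrm{SLD}(w,I)}\ \sum_{\sigma:[n]\to\mathbb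 Z_{>0}}q^{\mathrm{inv}_{\mathcal L}(\sigma)}x^\sigma .$$ It is a symmetric function over $\mathbb Q(q)$, homogeneous of degree $n$, and does not depend on the choice of $I$ (this is established separately); it is denoted $\mathrm{LLT}_w$. **Tableaux.** $\mathrm{SYT}(k,1^{n-k})$ is the set of standard Young tableaux of shape $(k,1^{n-k})$ (entries $1,\dots,n$, increasing left to right along rows and top to bottom along columns, first row of length $k$). For such a tableau $T$, $\mathrm{inv}_{\mathcal L}(T):=\mathrm{inv}_{\mathcal L}(\sigma_T)$, where $\sigma_T(u)=i$ if $u$ lies in the $i$-th row of $T$. -}

module Defs where

open import Data.Bool.Base using (if_then_else_; _∧_)
import Data.Bool.Properties as Bool
open import Data.Fin.Base using (Fin; toℕ)
import Data.Fin.Properties as Fin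
open import Data.Fin.Subset using (Subset; inside; outside; _∩_; _∪_; ⊥; ∣_∣)
open import Data.Fin.Subset.Properties using (_∈?_)
open import Data.Integer.Base as ℤ using (ℤ; +_; -[1+_]; 1ℤ; -1ℤ; 0ℤ)
open import Data.List.Base as List
  using (List; []; _∷_; _++_; map; concat; concatMap; foldr; filter; replicate;
         allFin; cartesianProduct; cartesianProductWith)
import Data.List.Properties as List
open import Data.List.Membership.Propositional using (_∈_)
import Data.List.Membership.DecPropositional as DecMembership
open import Data.List.Relation.Binary.Prefix.Heterogeneous using (Prefix)
open import Data.List.Relation.Binary.Prefix.Heterogeneous.Properties using (prefix?)
open import Data.List.Relation.Unary.All using (All; all?)
open import Data.List.Relation.Unary.Any using (Any; here; there; any?)
open import Data.List.Relation.Unary.Linked using (Linked; linked?)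
open import Data.List.Relation.Unary.Unique.Propositional using (Unique)
open import Data.Nat.Base as ℕ using (ℕ; zero; suc; _∸_; _≤_; _<_; _≥_; s≤s; z≤n)
open import Data.Nat.ListAction using (sum)
import Data.Nat.Properties as ℕ
open import Data.Product.Base using (_×_; _,_; uncurry)
open import Data.Rational.Base as ℚ using (ℚ; 0ℚ; 1ℚ)
import Data.Rational.Properties as ℚ
open import Data.Sum.Base using (_⊎_)
open import Data.Vec.Base as Vec using (Vec; []; _∷_; lookup; tabulate; toList)
import Data.Vec.Properties as Vec
open import Function.Base using (_∘_)
open import Relation.Binary.Core using (Rel)
open import Relation.Binary.PropositionalEquality
open import Relation.Nullary.Decidable using (Dec; yes; no; does; ¬?; _×-dec_; _⊎-dec_)
open import Relation.Unary using (Decidable)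

private
  variable
    A : Set
    N n : ℕ

------------------------------------------------------------------------
-- Polynomials over ℚ, as coefficient lists with the constant term first
-- (trailing zeros are allowed, hence the equality _≈ᴾ_).

Poly : Set
Poly = List ℚ

coeff : Poly → ℕ → ℚ
coeff []      _       = 0ℚ
coeff (a ∷ p) zero    = a
coeff (a ∷ p) (suc i) = coeff p i

infix  4 _≈ᴾ_
infixl 6 _+ᴾ_
infixl 7 _*ᴾ_

_≈ᴾ_ : Poly → Poly → Set
p ≈ᴾ r = ∀ i → coeff p i ≡ coeff r i

_+ᴾ_ : Poly → Poly → Poly
[]      +ᴾ r       = r
(a ∷ p) +ᴾ []      = a ∷ p
(a ∷ p) +ᴾ (b ∷ r) = (a ℚ.+ b) ∷ (p +ᴾ r)

-ᴾ_ : Poly → Poly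
-ᴾ p = map ℚ.-_ p

_*ᴾ_ : Poly → Poly → Poly
[]      *ᴾ r = []
(a ∷ p) *ᴾ r = map (a ℚ.*_) r +ᴾ (0ℚ ∷ p *ᴾ r)

0ᴾ 1ᴾ qᴾ : Poly
0ᴾ = []
1ᴾ = 1ℚ ∷ []
qᴾ = 0ℚ ∷ 1ℚ ∷ []

NonZeroᴾ : Poly → Set
NonZeroᴾ = Any (_≢ 0ℚ)

nonZeroᴾ? : Decidable NonZeroᴾ
nonZeroᴾ? = any? (λ a → ¬? (a ℚ.≟ 0ℚ))

-- ℚ[q] has no zero divisors: the lowest nonzero coefficients multiply.

coeff-+ : ∀ p r i → coeff (p +ᴾ r) i ≡ coeff p i ℚ.+ coeff r i
coeff-+ []      r       i       = sym (ℚ.+-identityˡ _)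
coeff-+ (a ∷ p) []      i       = sym (ℚ.+-identityʳ _)
coeff-+ (a ∷ p) (b ∷ r) zero    = refl
coeff-+ (a ∷ p) (b ∷ r) (suc i) = coeff-+ p r i

coeff-map : ∀ a r i → coeff (map (a ℚ.*_) r) i ≡ a ℚ.* coeff r i
coeff-map a []      i       = sym (ℚ.*-zeroʳ a)
coeff-map a (b ∷ r) zero    = refl
coeff-map a (b ∷ r) (suc i) = coeff-map a r i

coeff-∷ : ∀ a p r i →
  coeff ((a ∷ p) *ᴾ r) i ≡ a ℚ.* coeff r i ℚ.+ coeff (0ℚ ∷ p *ᴾ r) i
coeff-∷ a p r i =
  trans (coeff-+ (map (a ℚ.*_) r) _ i) (cong (ℚ._+ _) (coeff-map a r i))

a*0+0 : ∀ a → a ℚ.* 0ℚ ℚ.+ 0ℚ ≡ 0ℚ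
a*0+0 a = trans (ℚ.+-identityʳ _) (ℚ.*-zeroʳ a)

record Lowest (p : Poly) : Set where
  constructor lowest
  field
    order : ℕ
    ≢0    : coeff p order ≢ 0ℚ
    below : ∀ i → i < order → coeff p i ≡ 0ℚ

findLowest : ∀ {p} → NonZeroᴾ p → Lowest p
findLowest {a ∷ p} nz with a ℚ.≟ 0ℚ | nz
... | no  a≢0 | _        = lowest 0 a≢0 λ _ ()
... | yes a≡0 | here a≢0 = lowest 0 a≢0 λ _ ()
... | yes a≡0 | there nz′ = let open Lowest (findLowest nz′) in
  lowest (suc order) ≢0 λ { zero _ → a≡0 ; (suc i) (s≤s i<o) → below i i<o }

nonZero-coeff : ∀ {p} i → coeff p i ≢ 0ℚ → NonZeroᴾ p
nonZero-coeff {[]}    i       ≢0 with () ← ≢0 refl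
nonZero-coeff {a ∷ p} zero    ≢0 = here ≢0
nonZero-coeff {a ∷ p} (suc i) ≢0 = there (nonZero-coeff i ≢0)

module _ {r : Poly} (R : Lowest r) where
  open Lowest R

  below-* : ∀ p i → i < order → coeff (p *ᴾ r) i ≡ 0ℚ
  below-* []      i       i<o = refl
  below-* (a ∷ p) zero    i<o = trans (coeff-∷ a p r 0)
    (trans (cong (λ b → a ℚ.* b ℚ.+ 0ℚ) (below 0 i<o)) (a*0+0 a))
  below-* (a ∷ p) (suc i) i<o = trans (coeff-∷ a p r (suc i))
    (trans (cong₂ (λ b c → a ℚ.* b ℚ.+ c) (below (suc i) i<o)
             (below-* p i (ℕ.<-trans (ℕ.n<1+n i) i<o)))
           (a*0+0 a))

  shift-below : ∀ p i → i ≤ order → coeff (0ℚ ∷ p *ᴾ r) i ≡ 0ℚ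
  shift-below p zero    _   = refl
  shift-below p (suc i) i<o = below-* p i i<o

  order-* : ∀ p k → coeff p k ≢ 0ℚ → (∀ i → i < k → coeff p i ≡ 0ℚ) →
            coeff (p *ᴾ r) (k ℕ.+ order) ≡ coeff p k ℚ.* coeff r order
  order-* []      k       ≢0 _  with () ← ≢0 refl
  order-* (a ∷ p) zero    _  _  = trans (coeff-∷ a p r order)
    (trans (cong (a ℚ.* coeff r order ℚ.+_) (shift-below p order ℕ.≤-refl))
           (ℚ.+-identityʳ _))
  order-* (a ∷ p) (suc k) ≢0′ lo = trans (coeff-∷ a p r (suc k ℕ.+ order))
    (trans (cong₂ (λ b c → b ℚ.* coeff r (suc k ℕ.+ order) ℚ.+ c)
             (lo 0 (s≤s z≤n))
             (order-* p k ≢0′ (λ i i<k → lo (suc i) (s≤s i<k))))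
           (trans (cong (ℚ._+ (coeff p k ℚ.* coeff r order))
                    (ℚ.*-zeroˡ (coeff r (suc k ℕ.+ order))))
             (ℚ.+-identityˡ _)))

ℚ-*-nonZero : ∀ {a b} → a ≢ 0ℚ → b ≢ 0ℚ → a ℚ.* b ≢ 0ℚ
ℚ-*-nonZero {a} {b} a≢0 b≢0 ab≡0 = b≢0 (begin
  b                        ≡⟨ ℚ.*-identityˡ b ⟨
  1ℚ ℚ.* b                 ≡⟨ cong (ℚ._* b) (ℚ.*-inverseˡ a) ⟨
  (ℚ.1/ a) ℚ.* a ℚ.* b     ≡⟨ ℚ.*-assoc (ℚ.1/ a) a b ⟩
  (ℚ.1/ a) ℚ.* (a ℚ.* b)   ≡⟨ cong ((ℚ.1/ a) ℚ.*_) ab≡0 ⟩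
  (ℚ.1/ a) ℚ.* 0ℚ          ≡⟨ ℚ.*-zeroʳ (ℚ.1/ a) ⟩
  0ℚ                       ∎)
  where
  open ≡-Reasoning
  instance _ = ℚ.≢-nonZero a≢0

nonZeroᴾ-* : ∀ {p r} → NonZeroᴾ p → NonZeroᴾ r → NonZeroᴾ (p *ᴾ r)
nonZeroᴾ-* {p} {r} p≢0 r≢0 =
  nonZero-coeff {p *ᴾ r} (order P ℕ.+ order R)
    (λ eq → ℚ-*-nonZero (≢0 P) (≢0 R)
      (trans (sym (order-* R p (order P) (≢0 P) (below P))) eq))
  where
  open Lowest
  P = findLowest p≢0
  R = findLowest r≢0

------------------------------------------------------------------------
-- The field ℚ(q) of fractions of ℚ[q].

record ℚ⟨q⟩ : Set where
  constructor frac
  field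
    num   : Poly
    den   : Poly
    den≢0 : NonZeroᴾ den

open ℚ⟨q⟩ public

infix  4 _≈_
infixl 6 _+ᶠ_ _-ᶠ_
infixl 7 _*ᶠ_ _/ᶠ_
infix  8 _⁻¹

_≈_ : Rel ℚ⟨q⟩ _
x ≈ y = num x *ᴾ den y ≈ᴾ num y *ᴾ den x

1≢0ᴾ : NonZeroᴾ 1ᴾ
1≢0ᴾ = here λ ()

fromPoly : Poly → ℚ⟨q⟩
fromPoly p = frac p 1ᴾ 1≢0ᴾ

0ᶠ 1ᶠ q : ℚ⟨q⟩
0ᶠ = fromPoly 0ᴾ
1ᶠ = fromPoly 1ᴾ
q  = fromPoly qᴾ

_+ᶠ_ _-ᶠ_ _*ᶠ_ : ℚ⟨q⟩ → ℚ⟨q⟩ → ℚ⟨q⟩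
x +ᶠ y = frac (num x *ᴾ den y +ᴾ num y *ᴾ den x) (den x *ᴾ den y)
              (nonZeroᴾ-* (den≢0 x) (den≢0 y))
x -ᶠ y = x +ᶠ frac (-ᴾ num y) (den y) (den≢0 y)
x *ᶠ y = frac (num x *ᴾ num y) (den x *ᴾ den y)
              (nonZeroᴾ-* (den≢0 x) (den≢0 y))

-- Totalised by 0⁻¹ = 0; below it is applied only to nonzero elements.
_⁻¹ : ℚ⟨q⟩ → ℚ⟨q⟩
x ⁻¹ with nonZeroᴾ? (num x)
... | yes num≢0 = frac (den x) (num x) num≢0
... | no  _     = 0ᶠ

_/ᶠ_ : ℚ⟨q⟩ → ℚ⟨q⟩ → ℚ⟨q⟩
x /ᶠ y = x *ᶠ y ⁻¹

_^ℕ_ : ℚ⟨q⟩ → ℕ → ℚ⟨q⟩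
x ^ℕ zero  = 1ᶠ
x ^ℕ suc k = x *ᶠ x ^ℕ k

q^_ : ℤ → ℚ⟨q⟩
q^ (+ k)    = q ^ℕ k
q^ -[1+ k ] = (q ^ℕ suc k) ⁻¹

∑ : List A → (A → ℚ⟨q⟩) → ℚ⟨q⟩
∑ xs f = foldr (λ x s → f x +ᶠ s) 0ᶠ xs

∏ : List A → (A → ℚ⟨q⟩) → ℚ⟨q⟩
∏ xs f = foldr (λ x s → f x *ᶠ s) 1ᶠ xs

[_]q : ℕ → ℚ⟨q⟩
[ k ]q = (q^ (+ k) -ᶠ q^ (ℤ.- (+ k))) /ᶠ (q^ 1ℤ -ᶠ q^ -1ℤ)

[_]q! : ℕ → ℚ⟨q⟩
[ zero  ]q! = 1ᶠ
[ suc k ]q! = [ k ]q! *ᶠ [ suc k ]q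

[_]! : List ℕ → ℚ⟨q⟩
[ α ]! = ∏ α [_]q!

------------------------------------------------------------------------
-- Enumeration of words and their contents.

words : List A → ∀ n → List (Vec A n)
words xs zero    = [] ∷ []
words xs (suc n) = cartesianProductWith _∷_ xs (words xs n)

-- A letter i : Fin N stands for the variable x_{i+1}, and an exponent vector
-- a : Vec ℕ N for the monomial ∏ x_i^{a_i}.  Every monomial in x₁, x₂, … is of
-- this form once N is large enough.
content : List (Fin N) → Vec ℕ N
content us = tabulate λ i → List.length (filter (i Fin.≟_) us)

_≟ᵐ_ : (a b : Vec ℕ N) → Dec (a ≡ b)
_≟ᵐ_ = Vec.≡-dec ℕ._≟_

-- Formal power series in x₁, x₂, … over ℚ(q), given by their coefficients.
Series : Set
Series = ∀ {N} → Vec ℕ N → ℚ⟨q⟩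

------------------------------------------------------------------------
-- Tableaux (English notation, as lists of rows from top to bottom) and Schur
-- functions.

Tableau : ℕ → Set
Tableau N = List (List (Fin N))

fillings : List ℕ → ∀ N → List (Tableau N)
fillings []      N = [] ∷ []
fillings (k ∷ λs) N =
  cartesianProductWith _∷_ (map toList (words (allFin N) k)) (fillings λs N)

-- Prefix R lower upper says that the lower row is no longer than the upper one
-- and that R holds in each of its columns.
ColumnStrict : Tableau N → Set
ColumnStrict = Linked λ upper lower →
  Prefix (λ y x → toℕ x < toℕ y) lower upper

columnStrict? : Decidable (ColumnStrict {N})
columnStrict? = linked? λ upper lower →
  prefix? (λ y x → toℕ x ℕ.<? toℕ y) lower upper

IsSSYT : Tableau N → Set
IsSSYT T = All (Linked λ x y → toℕ x ≤ toℕ y) T × ColumnStrict T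

isSSYT? : Decidable (IsSSYT {N})
isSSYT? T = all? (linked? λ x y → toℕ x ℕ.≤? toℕ y) T ×-dec columnStrict? T

IsSYT : Tableau n → Set
IsSYT {n} T = All (Linked λ x y → toℕ x < toℕ y) T × ColumnStrict T
            × content (concat T) ≡ Vec.replicate n 1

isSYT? : Decidable (IsSYT {n})
isSYT? T = all? (linked? λ x y → toℕ x ℕ.<? toℕ y) T ×-dec columnStrict? T
     ×-dec content (concat T) ≟ᵐ Vec.replicate _ 1

SSYT : List ℕ → ∀ N → List (Tableau N)
SSYT λs N = filter isSSYT? (fillings λs N)

SYT : List ℕ → ∀ n → List (Tableau n)
SYT λs n = filter isSYT? (fillings λs n)

schur : List ℕ → Series
schur λs {N} a =
  ∑ (filter (λ T → content (concat T) ≟ᵐ a) (SSYT λs N)) λ _ → 1ᶠ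

-- A composition of n + 1 either starts with 1, or arises from a nonempty
-- composition of n by increasing the first part.
compositions : ℕ → List (List ℕ)
compositions zero    = [] ∷ []
compositions (suc n) =
  concatMap (λ α → (1 ∷ α) ∷ incrementHead α) (compositions n)
  where
  incrementHead : List ℕ → List (List ℕ)
  incrementHead []      = []
  incrementHead (k ∷ α) = (suc k ∷ α) ∷ []

partitions : ℕ → List (List ℕ)
partitions n = filter (linked? ℕ._≥?_) (compositions n)

-- f = ∑_λ c_λ s_λ over all partitions λ.  Since s_λ is homogeneous of degree
-- |λ|, only the partitions of the degree of a monomial contribute to its
-- coefficient.
IsSchurExpansion : Series → (List ℕ → ℚ⟨q⟩) → Set
IsSchurExpansion f c = ∀ {N} (a : Vec ℕ N) →
  f a ≈ ∑ (partitions (Vec.sum a)) λ λs → c λs *ᶠ schur λs a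

hook : ℕ → ℕ → List ℕ
hook k n = k ∷ replicate (n ∸ k) 1

-- σ_T; rows are counted from 1.
rowOf : Tableau n → Fin n → ℕ
rowOf []      u = 1
rowOf (r ∷ T) u = if does (u ∈ˡ? r) then 1 else suc (rowOf T u)
  where open DecMembership Fin._≟_ renaming (_∈?_ to _∈ˡ?_)

------------------------------------------------------------------------
-- Annular webs, up to isotopy: cut the annulus open along a radial segment and
-- perturb the web so that its vertices have distinct heights.  A level is the
-- list, from left to right, of the edges crossed by a radial segment, and
-- sweeping the segment upwards once around the annulus passes the vertices
-- one at a time.

data Vertex (E : Set) : Set where
  merge : (left right out : E) → Vertex E
  split : (inc left right : E) → Vertex E

outgoing : {E : Set} → Vertex E → List E
outgoing (merge _ _ z) = z ∷ []
outgoing (split _ x y) = x ∷ y ∷ []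

Conserves : {E : Set} → (E → ℕ) → Vertex E → Set
Conserves t (merge x y z) = t x ℕ.+ t y ≡ t z
Conserves t (split z x y) = t z ≡ t x ℕ.+ t y

infix 4 _—[_]→_

data _—[_]→_ {E : Set} : List E → Vertex E → List E → Set where
  merge : ∀ ls {x y z} rs → ls ++ x ∷ y ∷ rs —[ merge x y z ]→ ls ++ z ∷ rs
  split : ∀ ls {x y z} rs → ls ++ z ∷ rs —[ split z x y ]→ ls ++ x ∷ y ∷ rs

data Sweep {E : Set} : List E → List (Vertex E) → List E → Set where
  done : ∀ {ℓ} → Sweep ℓ [] ℓ
  step : ∀ {ℓ₁ ℓ₂ ℓ₃ v vs} →
         ℓ₁ —[ v ]→ ℓ₂ → Sweep ℓ₂ vs ℓ₃ → Sweep ℓ₁ (v ∷ vs) ℓ₃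

levels : {E : Set} {ℓ₁ ℓ₂ : List E} {vs : List (Vertex E)} →
         Sweep ℓ₁ vs ℓ₂ → List (List E)
levels {ℓ₁ = ℓ₁} done       = ℓ₁ ∷ []
levels {ℓ₁ = ℓ₁} (step _ s) = ℓ₁ ∷ levels s

-- The last three fields say that Edge is exactly the set of edges of the
-- graph.  A radial segment meets an edge at most once: the total thickness to
-- the left of the crossing is constant along the edge, and the edges at a level
-- have positive thickness.  Every edge either leaves exactly one vertex or is a
-- vertex-free circle, and circles cross the base level.
record AnnularWeb : Set where
  field
    #edges : ℕ

  Edge : Set
  Edge = Fin #edges

  field
    thickness      : Edge → ℕ
    thickness>0    : ∀ e → 0 < thickness e
    base           : List Edge
    vertices       : List (Vertex Edge)
    sweep          : Sweep base vertices base
    conserves      : All (Conserves thickness) vertices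
    levels-unique  : All Unique (levels sweep)
    sources-unique : Unique (concatMap outgoing vertices)
    exhaustive     : ∀ e → e ∈ base ⊎ e ∈ concatMap outgoing vertices

  degree : ℕ
  degree = sum (map thickness base)

open AnnularWeb public using (degree)

record RadialCut (w : AnnularWeb) : Set where
  open AnnularWeb w
  field
    level   : List Edge
    isLevel : level ∈ levels sweep

  -- t(I)
  initialThickness : List ℕ
  initialThickness = map thickness level

open RadialCut public using (initialThickness)

------------------------------------------------------------------------
-- Standard labeled loop decompositions.  The label u ∈ {1, …, n} is
-- represented by u - 1 : Fin n.

-- The consecutive intervals of lengths α₁, α₂, … starting at offset o.
blocksFrom : ∀ {n} → ℕ → List ℕ → List (Subset n)
blocksFrom o []      = []
blocksFrom o (a ∷ α) =
  tabulate (λ u → does (o ℕ.≤? toℕ u) ∧ does (toℕ u ℕ.<? o ℕ.+ a))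
  ∷ blocksFrom (o ℕ.+ a) α

_≟ˢ_ : (S T : Subset n) → Dec (S ≡ T)
_≟ˢ_ = Vec.≡-dec Bool._≟_

_≡_⊎ˢ_ : Subset n → Subset n → Subset n → Set
S ≡ A ⊎ˢ B = S ≡ A ∪ B × A ∩ B ≡ ⊥

_≟_⊎ˢ_ : (S A B : Subset n) → Dec (S ≡ A ⊎ˢ B)
S ≟ A ⊎ˢ B = (S ≟ˢ (A ∪ B)) ×-dec ((A ∩ B) ≟ˢ ⊥)

elements : Subset n → List (Fin n)
elements S = filter (_∈? S) (allFin _)

module _ (w : AnnularWeb) (I : RadialCut w) where
  open AnnularWeb w using (#edges; Edge; thickness; vertices)
  open RadialCut I using (level)

  private
    d : ℕ
    d = degree w

  blocks : List (Subset d)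
  blocks = blocksFrom 0 (initialThickness I)

  -- A map from edges to subsets of [n], as a vector indexed by the edges.
  Labelling : Set
  Labelling = Vec (Subset d) #edges

  Compatible : Labelling → Vertex Edge → Set
  Compatible L (merge x y z) = lookup L z ≡ lookup L x ⊎ˢ lookup L y
  Compatible L (split z x y) = lookup L z ≡ lookup L x ⊎ˢ lookup L y

  compatible? : ∀ L → Decidable (Compatible L)
  compatible? L (merge x y z) = lookup L z ≟ lookup L x ⊎ˢ lookup L y
  compatible? L (split z x y) = lookup L z ≟ lookup L x ⊎ˢ lookup L y

  IsSLD : Labelling → Set
  IsSLD L = map (lookup L) level ≡ blocks
          × (∀ e → ∣ lookup L e ∣ ≡ thickness e)
          × All (Compatible L) vertices

  isSLD? : Decidable IsSLD
  isSLD? L = List.≡-dec _≟ˢ_ (map (lookup L) level) blocks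
       ×-dec Fin.all? (λ e → ∣ lookup L e ∣ ℕ.≟ thickness e)
       ×-dec all? (compatible? L) vertices

  SLD : List Labelling
  SLD = filter isSLD? (words (words (outside ∷ inside ∷ []) d) #edges)

  blockPairs : Subset d → List (Fin d × Fin d)
  blockPairs B = filter (uncurry Fin._<?_) (cartesianProduct (elements B) (elements B))

  -- L_u enters a merge from the left exactly when u labels its left incoming
  -- edge.
  vertexPairs : Labelling → Vertex Edge → List (Fin d × Fin d)
  vertexPairs L (merge x y _) =
    cartesianProduct (elements (lookup L x)) (elements (lookup L y))
  vertexPairs L (split _ _ _) = []

  -- The multiset A_I(L).
  attackingPairs : Labelling → List (Fin d × Fin d)
  attackingPairs L =
    concatMap blockPairs blocks ++ concatMap (vertexPairs L) vertices

  ε : (Fin d → ℕ) → Fin d × Fin d → ℤ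
  ε σ (u , v) =
    if does (σ u ℕ.<? σ v ⊎-dec (σ v ℕ.≟ σ u ×-dec v Fin.<? u)) then 1ℤ else -1ℤ

  inv : Labelling → (Fin d → ℕ) → ℤ
  inv L σ = foldr (λ p s → ε σ p ℤ.+ s) 0ℤ (attackingPairs L)

  LLT : Series
  LLT {N} a = [ initialThickness I ]! ⁻¹ *ᶠ
    ∑ SLD λ L →
      ∑ (filter (λ σ → content (toList σ) ≟ᵐ a) (words (allFin N) d)) λ σ →
        q^ inv L (suc ∘ toℕ ∘ lookup σ)

{-# OPTIONS --safe #-}

-- Whether a letter of a word is smaller than a later one determines inv, so the
-- weight of a word depends only on its standardisation, equal letters increasing
-- from right to left.  The same holds for the indicator of the reading words of
-- semistandard tableaux of a fixed shape.  For such a weight g let c(b) be the sum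
-- of g over the words of content b, and let R(b, p, m) be the sum of g over the
-- words of content (b, p + 1, 1, …, 1) (with m ones) in which the last m letters
-- increase from left to right and the first of them stands after some copy of the
-- repeated letter x.  Deciding whether x or its successor comes first, and merging
-- the successor into x in the second case, gives
--   R((b, p + 1), 0, m) = R(b, p, m + 1) + R(b, p + 1, m),
-- where R(b, p, 0) = c(b, p + 1).  Hence the contents determine R, and R commutes
-- with the Schur expansion.  For the empty b, the words counted by R are the words
-- of rows of the standard tableaux of shape (p + 1, 1^m), and the only reading word
-- of a semistandard tableau among them is 0 … 0 1 2 … m, of shape (p + 1, 1^m).
module Submission where

open import Defs
open import Algebra.Bundles using (CommutativeRing)
open import Data.Bool.Base using (if_then_else_; true; false)
open import Data.Empty using (⊥-elim)
open import Data.Fin.Base as Fin using (Fin; toℕ; fromℕ<; zero; suc)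
import Data.Fin.Properties as Fin
open import Data.Integer.Base as ℤ using (ℤ; 0ℤ; 1ℤ; -1ℤ)
open import Data.List.Base using (List; []; _∷_; [_]; _++_; map; concat; concatMap;
  foldr; filter; replicate; length; allFin; reverse; take; drop)
import Data.List.Base as List using (tabulate)
import Data.List.Membership.DecPropositional as DecMembership
open import Data.List.Membership.Propositional using (_∈_; _∉_; find; lose)
open import Data.List.Membership.Propositional.Properties
open import Data.List.Membership.Propositional.Properties.WithK using (unique∧set⇒bag)
import Data.List.Properties as List
open import Data.List.Relation.Binary.BagAndSetEquality using (∼bag⇒↭)
open import Data.List.Relation.Binary.Permutation.Propositional
  using (_↭_; ↭-refl; ↭-reflexive; ↭-prep; ↭-trans; ↭-sym)
  renaming (refl to refl↭; prep to prep↭; swap to swap↭; trans to trans↭)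
import Data.List.Relation.Binary.Permutation.Propositional.Properties as ↭
open import Data.List.Relation.Binary.Prefix.Heterogeneous using (Prefix; []; _∷_)
import Data.List.Relation.Binary.Prefix.Heterogeneous.Properties as Prefix
open import Data.List.Relation.Unary.All as All using (All; []; _∷_; all?)
import Data.List.Relation.Unary.All.Properties as All
open import Data.List.Relation.Unary.AllPairs as AllPairs using (AllPairs; []; _∷_)
import Data.List.Relation.Unary.AllPairs.Properties as AllPairs
open import Data.List.Relation.Unary.Any using (here; there)
open import Data.List.Relation.Unary.Linked as Linked using (Linked; []; [-]; _∷_; linked?)
import Data.List.Relation.Unary.Linked.Properties as Linked
open import Data.List.Relation.Unary.Unique.Propositional using (Unique)
import Data.List.Relation.Unary.Unique.Propositional.Properties as Unique
open import Data.Nat.Base as ℕ using (ℕ; zero; suc; _<_; _≤_; _≥_; z≤n)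
open import Data.Nat.ListAction using (sum)
import Data.Nat.Properties as ℕ
open import Data.Product.Base as Product using (_×_; _,_; proj₁; proj₂; ∃; Σ-syntax)
open import Data.Rational.Base as ℚ using (0ℚ)
import Data.Rational.Properties as ℚ
open import Data.Sum.Base using (_⊎_; inj₁; inj₂)
open import Data.Vec.Base as Vec using (Vec; []; _∷_; toList; tabulate; lookup)
import Data.Vec.Properties as Vec
open import Function.Base using (_∘_; id; flip)
open import Function.Bundles using (mk⇔)
open import Relation.Binary.Core using (Rel)
open import Relation.Binary.Definitions using (tri<; tri≈; tri>)
open import Relation.Binary.PropositionalEquality
  using (_≡_; _≢_; refl; sym; trans; cong; cong₂; subst; subst₂; module ≡-Reasoning)
open import Relation.Nullary.Decidable using (yes; no; does; ¬?; dec-true; dec-false;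
  _×-dec_; _⊎-dec_; does-⇔)
open import Relation.Nullary.Negation using (¬_; contradiction)
open import Relation.Unary using (Decidable; Pred)

-- The recursion for R is the Pieri rule `h_(p+1) e_(m+1) = s_(p+1,1^(m+1)) + s_(p+2,1^m)` in terms
-- of words. When the content sums of g are the monomial coefficients of a symmetric function f,
-- c(b) is the Hall pairing of f with `h_b`, and R(b, p, m) is its pairing with `h_b s_(p+1,1^m)`;
-- the case p = 0 is `e_(m+1)`. The obstacle is that the LLT weight and the weight built from the
-- Schur expansion need not agree on any single word: the hypothesis equates only their sums over
-- all words of a given content, and the words counted by R do not form full content classes. The
-- recursion expresses R through full classes by one subtraction per step. Each step moves a part
-- into b, which is why b stays arbitrary although only the empty b matters in the end.

private
  variable
    A B : Set
    N n : ℕ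

-- Power series products and the field of rational functions

module Convolution {c ℓ} (R : CommutativeRing c ℓ) where
  open CommutativeRing R renaming (_≈_ to _∼_; refl to ∼-refl; sym to ∼-sym; trans to ∼-trans)
  open import Algebra.Solver.Ring.NaturalCoefficients.Default commutativeSemiring
  open import Relation.Binary.Reasoning.Setoid setoid

  -- Polynomials are compared by coefficients because lists may end in zeros, so the ring laws are
  -- proved for coefficient functions and then transferred. Over an abstract ring no rational
  -- arithmetic unfolds on the way.
  conv : (ℕ → Carrier) → (ℕ → Carrier) → ℕ → Carrier
  conv f g zero    = f 0 * g 0
  conv f g (suc i) = f 0 * g (suc i) + conv (λ j → f (suc j)) g i

  conv-cong : ∀ {f f′ g g′} → (∀ i → f i ∼ f′ i) → (∀ i → g i ∼ g′ i) →
              ∀ i → conv f g i ∼ conv f′ g′ i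
  conv-cong p r zero    = *-cong (p 0) (r 0)
  conv-cong p r (suc i) =
    +-cong (*-cong (p 0) (r (suc i))) (conv-cong (λ j → p (suc j)) r i)

  conv-zeroˡ : ∀ f g → (∀ i → f i ∼ 0#) → ∀ i → conv f g i ∼ 0#
  conv-zeroˡ f g f∼0 zero    = ∼-trans (*-congʳ (f∼0 0)) (zeroˡ _)
  conv-zeroˡ f g f∼0 (suc i) = ∼-trans
    (+-cong (∼-trans (*-congʳ (f∼0 0)) (zeroˡ _))
            (conv-zeroˡ (λ j → f (suc j)) g (λ j → f∼0 (suc j)) i))
    (+-identityˡ 0#)

  -- The definition splits off the term with the first coefficient of `f`; commutativity also
  -- requires splitting off the one with the first coefficient of `g`.
  conv-sucʳ : ∀ f g i →
    conv f g (suc i) ∼ conv f (λ j → g (suc j)) i + f (suc i) * g 0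
  conv-sucʳ f g zero    = ∼-refl
  conv-sucʳ f g (suc i) = ∼-trans
    (+-congˡ (conv-sucʳ (λ j → f (suc j)) g i)) (∼-sym (+-assoc _ _ _))

  conv-comm : ∀ f g i → conv f g i ∼ conv g f i
  conv-comm f g zero    = *-comm _ _
  conv-comm f g (suc i) = begin
    f 0 * g (suc i) + conv (λ j → f (suc j)) g i  ≈⟨ +-cong (*-comm _ _) (conv-comm _ g i) ⟩
    g (suc i) * f 0 + conv g (λ j → f (suc j)) i  ≈⟨ +-comm _ _ ⟩
    conv g (λ j → f (suc j)) i + g (suc i) * f 0  ≈⟨ conv-sucʳ g f i ⟨
    conv g f (suc i)                              ∎

  conv-distribˡ : ∀ f g h i → conv f (λ j → g j + h j) i ∼ conv f g i + conv f h i
  conv-distribˡ f g h zero    = distribˡ _ _ _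
  conv-distribˡ f g h (suc i) = ∼-trans
    (+-cong (distribˡ _ _ _) (conv-distribˡ (λ j → f (suc j)) g h i))
    (solve 4 (λ x y z w → (x :+ y) :+ (z :+ w) := (x :+ z) :+ (y :+ w)) ∼-refl
      (f 0 * g (suc i)) (f 0 * h (suc i)) _ _)

  conv-distribʳ : ∀ f g h i → conv (λ j → g j + h j) f i ∼ conv g f i + conv h f i
  conv-distribʳ f g h i = ∼-trans (conv-comm _ f i) (∼-trans (conv-distribˡ f g h i)
    (+-cong (conv-comm f g i) (conv-comm f h i)))

  conv-scale : ∀ a f g i → conv (λ j → a * f j) g i ∼ a * conv f g i
  conv-scale a f g zero    = *-assoc _ _ _
  conv-scale a f g (suc i) = ∼-trans
    (+-cong (*-assoc _ _ _) (conv-scale a (λ j → f (suc j)) g i)) (∼-sym (distribˡ _ _ _))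

  conv-assoc : ∀ f g h i → conv (conv f g) h i ∼ conv f (conv g h) i
  conv-assoc f g h zero    = *-assoc _ _ _
  conv-assoc f g h (suc i) = begin
    f 0 * g 0 * h (suc i) + conv (λ j → f 0 * g (suc j) + conv f′ g j) h i
      ≈⟨ +-congˡ (conv-distribʳ h (λ j → f 0 * g (suc j)) (conv f′ g) i) ⟩
    f 0 * g 0 * h (suc i) + (conv (λ j → f 0 * g (suc j)) h i + conv (conv f′ g) h i)
      ≈⟨ +-congˡ (+-cong (conv-scale (f 0) (λ j → g (suc j)) h i) (conv-assoc f′ g h i)) ⟩
    f 0 * g 0 * h (suc i) + (f 0 * conv (λ j → g (suc j)) h i + conv f′ (conv g h) i)
      ≈⟨ solve 5 (λ x y z u v → x :* y :* z :+ (x :* u :+ v) := x :* (y :* z :+ u) :+ v)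
           ∼-refl (f 0) (g 0) (h (suc i)) _ _ ⟩
    f 0 * (g 0 * h (suc i) + conv (λ j → g (suc j)) h i) + conv f′ (conv g h) i ∎
    where f′ = λ j → f (suc j)

open Convolution ℚ.+-*-commutativeRing

-- A record, so that the two polynomials can be recovered from the type.
infix 4 _≋_
record _≋_ (p r : Poly) : Set where
  constructor coeffs
  field at : p ≈ᴾ r
open _≋_

coeff-* : ∀ p r i → coeff (p *ᴾ r) i ≡ conv (coeff p) (coeff r) i
coeff-* []      r i       = sym (conv-zeroˡ (λ _ → 0ℚ) (coeff r) (λ _ → refl) i)
coeff-* (a ∷ p) r zero    = trans (coeff-∷ a p r 0) (ℚ.+-identityʳ _)
coeff-* (a ∷ p) r (suc i) =
  trans (coeff-∷ a p r (suc i)) (cong (a ℚ.* coeff r (suc i) ℚ.+_) (coeff-* p r i))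

coeff-neg : ∀ p i → coeff (-ᴾ p) i ≡ ℚ.- coeff p i
coeff-neg []      i       = refl
coeff-neg (a ∷ p) zero    = refl
coeff-neg (a ∷ p) (suc i) = coeff-neg p i

+ᴾ-cong : ∀ {p p′ r r′} → p ≋ p′ → r ≋ r′ → p +ᴾ r ≋ p′ +ᴾ r′
+ᴾ-cong {p} {p′} {r} {r′} e f .at i = begin
  coeff (p +ᴾ r) i          ≡⟨ coeff-+ p r i ⟩
  coeff p i ℚ.+ coeff r i   ≡⟨ cong₂ ℚ._+_ (e .at i) (f .at i) ⟩
  coeff p′ i ℚ.+ coeff r′ i ≡⟨ coeff-+ p′ r′ i ⟨
  coeff (p′ +ᴾ r′) i        ∎
  where open ≡-Reasoning

*ᴾ-cong : ∀ {p p′ r r′} → p ≋ p′ → r ≋ r′ → p *ᴾ r ≋ p′ *ᴾ r′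
*ᴾ-cong {p} {p′} {r} {r′} e f .at i = begin
  coeff (p *ᴾ r) i               ≡⟨ coeff-* p r i ⟩
  conv (coeff p) (coeff r) i     ≡⟨ conv-cong (e .at) (f .at) i ⟩
  conv (coeff p′) (coeff r′) i   ≡⟨ coeff-* p′ r′ i ⟨
  coeff (p′ *ᴾ r′) i             ∎
  where open ≡-Reasoning

*ᴾ-assoc : ∀ p r s → (p *ᴾ r) *ᴾ s ≋ p *ᴾ (r *ᴾ s)
*ᴾ-assoc p r s .at i = begin
  coeff (p *ᴾ r *ᴾ s) i                        ≡⟨ coeff-* (p *ᴾ r) s i ⟩
  conv (coeff (p *ᴾ r)) (coeff s) i            ≡⟨ conv-cong (coeff-* p r) (λ _ → refl) i ⟩
  conv (conv (coeff p) (coeff r)) (coeff s) i  ≡⟨ conv-assoc (coeff p) (coeff r) (coeff s) i ⟩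
  conv (coeff p) (conv (coeff r) (coeff s)) i  ≡⟨ conv-cong (λ _ → refl) (coeff-* r s) i ⟨
  conv (coeff p) (coeff (r *ᴾ s)) i            ≡⟨ coeff-* p (r *ᴾ s) i ⟨
  coeff (p *ᴾ (r *ᴾ s)) i                      ∎
  where open ≡-Reasoning

*ᴾ-comm : ∀ p r → p *ᴾ r ≋ r *ᴾ p
*ᴾ-comm p r .at i =
  trans (coeff-* p r i) (trans (conv-comm (coeff p) (coeff r) i) (sym (coeff-* r p i)))

*ᴾ-identityˡ : ∀ p → 1ᴾ *ᴾ p ≋ p
*ᴾ-identityˡ p .at zero    = trans (coeff-* 1ᴾ p 0) (ℚ.*-identityˡ _)
*ᴾ-identityˡ p .at (suc i) = trans (coeff-* 1ᴾ p (suc i))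
  (trans (cong₂ ℚ._+_ (ℚ.*-identityˡ (coeff p (suc i))) (conv-zeroˡ (λ _ → 0ℚ) (coeff p) (λ _ → refl) i))
         (ℚ.+-identityʳ (coeff p (suc i))))

*ᴾ-distribʳ : ∀ s p r → (p +ᴾ r) *ᴾ s ≋ p *ᴾ s +ᴾ r *ᴾ s
*ᴾ-distribʳ s p r .at i = begin
  coeff ((p +ᴾ r) *ᴾ s) i                          ≡⟨ coeff-* (p +ᴾ r) s i ⟩
  conv (coeff (p +ᴾ r)) (coeff s) i                ≡⟨ conv-cong (coeff-+ p r) (λ _ → refl) i ⟩
  conv (λ j → coeff p j ℚ.+ coeff r j) (coeff s) i ≡⟨ conv-distribʳ (coeff s) (coeff p) (coeff r) i ⟩
  conv (coeff p) (coeff s) i ℚ.+ conv (coeff r) (coeff s) i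
    ≡⟨ cong₂ ℚ._+_ (coeff-* p s i) (coeff-* r s i) ⟨
  coeff (p *ᴾ s) i ℚ.+ coeff (r *ᴾ s) i            ≡⟨ coeff-+ (p *ᴾ s) (r *ᴾ s) i ⟨
  coeff (p *ᴾ s +ᴾ r *ᴾ s) i                       ∎
  where open ≡-Reasoning

polyRing : CommutativeRing _ _
polyRing = record
  { Carrier = Poly ; _≈_ = _≋_ ; _+_ = _+ᴾ_ ; _*_ = _*ᴾ_ ; -_ = -ᴾ_ ; 0# = 0ᴾ ; 1# = 1ᴾ
  ; isCommutativeRing = record
    { isRing = record
      { +-isAbelianGroup = record
        { isGroup = record
          { isMonoid = record
            { isSemigroup = record
              { isMagma = record
                { isEquivalence = record
                  { refl  = coeffs λ _ → refl
                  ; sym   = λ e → coeffs λ i → sym (e .at i)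
                  ; trans = λ e f → coeffs λ i → trans (e .at i) (f .at i)
                  }
                ; ∙-cong = +ᴾ-cong
                }
              ; assoc = +ᴾ-assoc
              }
            ; identity = (λ _ → coeffs λ _ → refl) , λ p → coeffs λ i →
                trans (coeff-+ p [] i) (ℚ.+-identityʳ _)
            }
          ; inverse = (λ p → coeffs λ i → trans (coeff-+ (-ᴾ p) p i)
                          (trans (cong (ℚ._+ coeff p i) (coeff-neg p i)) (ℚ.+-inverseˡ (coeff p i))))
                      , (λ p → coeffs λ i → trans (coeff-+ p (-ᴾ p) i)
                          (trans (cong (coeff p i ℚ.+_) (coeff-neg p i)) (ℚ.+-inverseʳ (coeff p i))))
          ; ⁻¹-cong = λ {p} {r} e → coeffs λ i →
              trans (coeff-neg p i) (trans (cong ℚ.-_ (e .at i)) (sym (coeff-neg r i)))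
          }
        ; comm = λ p r → coeffs λ i →
            trans (coeff-+ p r i) (trans (ℚ.+-comm (coeff p i) (coeff r i)) (sym (coeff-+ r p i)))
        }
      ; *-cong = *ᴾ-cong
      ; *-assoc = *ᴾ-assoc
      ; *-identity = *ᴾ-identityˡ , λ p → ≋-trans (*ᴾ-comm p 1ᴾ) (*ᴾ-identityˡ p)
      ; distrib = (λ s p r → ≋-trans (*ᴾ-comm s (p +ᴾ r))
                    (≋-trans (*ᴾ-distribʳ s p r) (+ᴾ-cong (*ᴾ-comm p s) (*ᴾ-comm r s))))
                  , *ᴾ-distribʳ
      }
    ; *-comm = *ᴾ-comm
    }
  }
  where
  ≋-trans : ∀ {p r s} → p ≋ r → r ≋ s → p ≋ s
  ≋-trans e f = coeffs λ i → trans (e .at i) (f .at i)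

  +ᴾ-assoc : ∀ p r s → (p +ᴾ r) +ᴾ s ≋ p +ᴾ (r +ᴾ s)
  +ᴾ-assoc p r s .at i = begin
    coeff (p +ᴾ r +ᴾ s) i                       ≡⟨ coeff-+ (p +ᴾ r) s i ⟩
    coeff (p +ᴾ r) i ℚ.+ coeff s i              ≡⟨ cong (ℚ._+ coeff s i) (coeff-+ p r i) ⟩
    coeff p i ℚ.+ coeff r i ℚ.+ coeff s i       ≡⟨ ℚ.+-assoc (coeff p i) _ _ ⟩
    coeff p i ℚ.+ (coeff r i ℚ.+ coeff s i)     ≡⟨ cong (coeff p i ℚ.+_) (coeff-+ r s i) ⟨
    coeff p i ℚ.+ coeff (r +ᴾ s) i              ≡⟨ coeff-+ p (r +ᴾ s) i ⟨
    coeff (p +ᴾ (r +ᴾ s)) i                     ∎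
    where open ≡-Reasoning

-- The commutative ring of fractions of polynomials

module Fractions where
  open CommutativeRing polyRing
    renaming (_≈_ to _≈ₚ_; refl to ≋-refl; sym to ≋-sym; trans to ≋-trans)
    hiding (_≉_)
  open import Algebra.Solver.Ring.NaturalCoefficients.Default commutativeSemiring
  open import Algebra.Properties.Ring ring using (-‿distribˡ-*)
  open import Algebra.Properties.AbelianGroup +-abelianGroup using (//-rightDividesˡ)
  open import Relation.Binary.Reasoning.Setoid setoid

  nonZeroᴾ⇒≉0 : ∀ {p} → NonZeroᴾ p → ¬ p ≋ 0ᴾ
  nonZeroᴾ⇒≉0 nz e = ≢0 (e .at order)
    where open Lowest (findLowest nz)

  ¬nonZeroᴾ⇒≈0 : ∀ {p} → ¬ NonZeroᴾ p → p ≋ 0ᴾ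
  ¬nonZeroᴾ⇒≈0 {p} ¬nz .at i with coeff p i ℚ.≟ 0ℚ
  ... | yes eq  = eq
  ... | no  neq = contradiction (nonZero-coeff {p} i neq) ¬nz

  -- A nonzero `p - r` times `d` would be a nonzero polynomial equal to 0. Transitivity of equality
  -- of fractions rests on this: the middle denominator has to be cancelled.
  *-cancelʳ : ∀ {p r d} → NonZeroᴾ d → p * d ≋ r * d → p ≋ r
  *-cancelʳ {p} {r} {d} d≢0 e with nonZeroᴾ? (p - r)
  ... | yes nz = ⊥-elim (nonZeroᴾ⇒≉0 (nonZeroᴾ-* nz d≢0) (begin
    (p - r) * d        ≈⟨ distribʳ d p (- r) ⟩
    p * d + - r * d    ≈⟨ +-cong e (≋-sym (-‿distribˡ-* r d)) ⟩
    r * d - r * d      ≈⟨ -‿inverseʳ (r * d) ⟩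
    0ᴾ                 ∎))
  ... | no ¬nz = begin
    p            ≈⟨ //-rightDividesˡ r p ⟨
    p - r + r    ≈⟨ +-congʳ (¬nonZeroᴾ⇒≈0 ¬nz) ⟩
    0ᴾ + r       ≈⟨ +-identityˡ r ⟩
    r            ∎

  infix 4 _≃_
  record _≃_ (x y : ℚ⟨q⟩) : Set where
    constructor cross
    field crossed : num x *ᴾ den y ≋ num y *ᴾ den x
  open _≃_

  ≃⇒≈ : ∀ {x y} → x ≃ y → x ≈ y
  ≃⇒≈ e = crossed e .at

  ≈⇒≃ : ∀ {x y} → x ≈ y → x ≃ y
  ≈⇒≃ e = cross (coeffs e)

  ≃-trans : ∀ {x y z} → x ≃ y → y ≃ z → x ≃ z
  ≃-trans {x} {y} {z} (cross e) (cross f) = cross (*-cancelʳ (den≢0 y) (begin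
    num x * den z * den y  ≈⟨ swap (num x) (den z) (den y) ⟩
    num x * den y * den z  ≈⟨ *-congʳ e ⟩
    num y * den x * den z  ≈⟨ swap (num y) (den x) (den z) ⟩
    num y * den z * den x  ≈⟨ *-congʳ f ⟩
    num z * den y * den x  ≈⟨ swap (num z) (den y) (den x) ⟩
    num z * den x * den y  ∎))
    where
    swap : ∀ a b c → a * b * c ≋ a * c * b
    swap = solve 3 (λ a b c → a :* b :* c := a :* c :* b) ≋-refl

  +ᶠ-cong : ∀ {x x′ y y′} → x ≃ x′ → y ≃ y′ → x +ᶠ y ≃ x′ +ᶠ y′
  +ᶠ-cong {x} {x′} {y} {y′} (cross e) (cross f) = cross (begin
    (num x * den y + num y * den x) * (den x′ * den y′)
      ≈⟨ shuffle (num x) (den y) (num y) (den x) (den x′) (den y′) ⟩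
    num x * den x′ * (den y * den y′) + num y * den y′ * (den x * den x′)
      ≈⟨ +-cong (*-congʳ e) (*-congʳ f) ⟩
    num x′ * den x * (den y * den y′) + num y′ * den y * (den x * den x′)
      ≈⟨ solve 6 (λ a b c d e f → a :* d :* (f :* b) :+ c :* f :* (d :* e)
                    := (a :* b :+ c :* e) :* (d :* f)) ≋-refl
           (num x′) (den y′) (num y′) (den x) (den x′) (den y) ⟩
    (num x′ * den y′ + num y′ * den x′) * (den x * den y) ∎)
    where
    shuffle : ∀ a b c d e f → (a * b + c * d) * (e * f) ≋ a * e * (b * f) + c * f * (d * e)
    shuffle = solve 6 (λ a b c d e f → (a :* b :+ c :* d) :* (e :* f)
                         := a :* e :* (b :* f) :+ c :* f :* (d :* e)) ≋-refl

  *ᶠ-cong : ∀ {x x′ y y′} → x ≃ x′ → y ≃ y′ → x *ᶠ y ≃ x′ *ᶠ y′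
  *ᶠ-cong {x} {x′} {y} {y′} (cross e) (cross f) = cross (begin
    num x * num y * (den x′ * den y′)    ≈⟨ interchange (num x) (num y) (den x′) (den y′) ⟩
    num x * den x′ * (num y * den y′)    ≈⟨ *-cong e f ⟩
    num x′ * den x * (num y′ * den y)    ≈⟨ interchange (num x′) (den x) (num y′) (den y) ⟩
    num x′ * num y′ * (den x * den y)    ∎)
    where
    interchange : ∀ a b c d → a * b * (c * d) ≋ a * c * (b * d)
    interchange = solve 4 (λ a b c d → a :* b :* (c :* d) := a :* c :* (b :* d)) ≋-refl

  -ᶠ_ : ℚ⟨q⟩ → ℚ⟨q⟩
  -ᶠ x = frac (-ᴾ num x) (den x) (den≢0 x)

  -ᶠ-cong : ∀ {x y} → x ≃ y → -ᶠ x ≃ -ᶠ y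
  -ᶠ-cong {x} {y} (cross e) = cross (begin
    - num x * den y    ≈⟨ -‿distribˡ-* (num x) (den y) ⟨
    - (num x * den y)  ≈⟨ -‿cong e ⟩
    - (num y * den x)  ≈⟨ -‿distribˡ-* (num y) (den x) ⟩
    - num y * den x    ∎)

  -ᶠ-inverseˡ : ∀ x → -ᶠ x +ᶠ x ≃ 0ᶠ
  -ᶠ-inverseˡ x = cross (begin
    (- num x * den x + num x * den x) * 1ᴾ  ≈⟨ *-identityʳ _ ⟩
    - num x * den x + num x * den x         ≈⟨ distribʳ (den x) (- num x) (num x) ⟨
    (- num x + num x) * den x               ≈⟨ *-congʳ (-‿inverseˡ (num x)) ⟩
    0ᴾ * den x                              ≈⟨ zeroˡ (den x) ⟩
    0ᴾ                                      ≈⟨ zeroˡ (den x * den x) ⟨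
    0ᴾ * (den x * den x)                    ∎)

  +ᶠ-comm : ∀ x y → x +ᶠ y ≃ y +ᶠ x
  +ᶠ-comm x y = cross (solve 4 (λ a b c d → (a :* d :+ c :* b) :* (d :* b)
                          := (c :* b :+ a :* d) :* (b :* d)) ≋-refl
                  (num x) (den x) (num y) (den y))

  +ᶠ-identityˡ : ∀ x → 0ᶠ +ᶠ x ≃ x
  +ᶠ-identityˡ x = cross (solve 2 (λ a b → (con 0 :* b :+ a :* con 1) :* b
                             := a :* (con 1 :* b)) ≋-refl (num x) (den x))

  *ᶠ-comm : ∀ x y → x *ᶠ y ≃ y *ᶠ x
  *ᶠ-comm x y = cross (*-cong (*-comm (num x) (num y)) (*-comm (den y) (den x)))

  *ᶠ-identityˡ : ∀ x → 1ᶠ *ᶠ x ≃ x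
  *ᶠ-identityˡ x = cross (solve 2 (λ a b → (con 1 :* a) :* b := a :* (con 1 :* b)) ≋-refl
                           (num x) (den x))

  *ᶠ-distribʳ : ∀ z x y → (x +ᶠ y) *ᶠ z ≃ x *ᶠ z +ᶠ y *ᶠ z
  *ᶠ-distribʳ z x y = cross (solve 6 (λ a b c d e f →
      (a :* d :+ c :* b) :* e :* ((b :* f) :* (d :* f))
      := (a :* e :* (d :* f) :+ c :* e :* (b :* f)) :* (b :* d :* f)) ≋-refl
    (num x) (den x) (num y) (den y) (num z) (den z))

  fractionField : CommutativeRing _ _
  fractionField = record
    { Carrier = ℚ⟨q⟩ ; _≈_ = _≃_ ; _+_ = _+ᶠ_ ; _*_ = _*ᶠ_ ; -_ = -ᶠ_ ; 0# = 0ᶠ ; 1# = 1ᶠ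
    ; isCommutativeRing = record
      { isRing = record
        { +-isAbelianGroup = record
          { isGroup = record
            { isMonoid = record
              { isSemigroup = record
                { isMagma = record
                  { isEquivalence = record
                    { refl  = cross ≋-refl
                    ; sym   = λ e → cross (≋-sym (crossed e))
                    ; trans = ≃-trans
                    }
                  ; ∙-cong = +ᶠ-cong
                  }
                ; assoc = λ x y z → cross (solve 6 (λ a b c d e f →
                    ((a :* d :+ c :* b) :* f :+ e :* (b :* d)) :* (b :* (d :* f))
                    := (a :* (d :* f) :+ (c :* f :+ e :* d) :* b) :* (b :* d :* f)) ≋-refl
                    (num x) (den x) (num y) (den y) (num z) (den z))
                }
              ; identity = +ᶠ-identityˡ , λ x → ≃-trans (+ᶠ-comm x 0ᶠ) (+ᶠ-identityˡ x)
              }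
            ; inverse = -ᶠ-inverseˡ , λ x → ≃-trans (+ᶠ-comm x (-ᶠ x)) (-ᶠ-inverseˡ x)
            ; ⁻¹-cong = -ᶠ-cong
            }
          ; comm = +ᶠ-comm
          }
        ; *-cong = *ᶠ-cong
        ; *-assoc = λ x y z → cross
            (*-cong (*-assoc (num x) (num y) (num z))
                    (≋-sym (*-assoc (den x) (den y) (den z))))
        ; *-identity = *ᶠ-identityˡ , λ x → ≃-trans (*ᶠ-comm x 1ᶠ) (*ᶠ-identityˡ x)
        ; distrib = (λ z x y → ≃-trans (*ᶠ-comm z (x +ᶠ y)) (≃-trans (*ᶠ-distribʳ z x y)
                        (+ᶠ-cong (*ᶠ-comm x z) (*ᶠ-comm y z))))
                    , *ᶠ-distribʳ
        }
      ; *-comm = *ᶠ-comm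
      }
    }

-- Interleavings and finite sums

-- The shuffles of two words, listed with multiplicity, so that summing over the list is the shuffle
-- product.
ins : List A → List A → List (List A)
ins []       us       = us ∷ []
ins (v ∷ vs) []       = (v ∷ vs) ∷ []
ins (v ∷ vs) (u ∷ us) = map (v ∷_) (ins vs (u ∷ us)) ++ map (u ∷_) (ins (v ∷ vs) us)

ins-[]ʳ : (vs : List A) → ins vs [] ≡ vs ∷ []
ins-[]ʳ []       = refl
ins-[]ʳ (v ∷ vs) = refl

ins-↭ : ∀ (vs us : List A) {z} → z ∈ ins vs us → z ↭ vs ++ us
ins-↭ []       us       (here refl) = ↭-refl
ins-↭ (v ∷ vs) []       (here refl) = ↭-reflexive (sym (List.++-identityʳ _))
ins-↭ (v ∷ vs) (u ∷ us) z∈ with ∈-++⁻ (map (v ∷_) (ins vs (u ∷ us))) z∈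
... | inj₁ z∈l with _ , w∈ , refl ← ∈-map⁻ (v ∷_) z∈l = ↭-prep v (ins-↭ vs (u ∷ us) w∈)
... | inj₂ z∈r with _ , w∈ , refl ← ∈-map⁻ (u ∷_) z∈r =
  ↭-trans (↭-prep u (ins-↭ (v ∷ vs) us w∈)) (↭-sym (↭.shift u (v ∷ vs) us))

map-ins : ∀ (f : A → B) vs us → ins (map f vs) (map f us) ≡ map (map f) (ins vs us)
map-ins f []       us       = refl
map-ins f (v ∷ vs) []       = refl
map-ins f (v ∷ vs) (u ∷ us) = begin
  map (f v ∷_) (ins (map f vs) (map f (u ∷ us))) ++
  map (f u ∷_) (ins (map f (v ∷ vs)) (map f us))
    ≡⟨ cong₂ (λ x y → map (f v ∷_) x ++ map (f u ∷_) y)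
             (map-ins f vs (u ∷ us)) (map-ins f (v ∷ vs) us) ⟩
  map (f v ∷_) (map (map f) (ins vs (u ∷ us))) ++
  map (f u ∷_) (map (map f) (ins (v ∷ vs) us))
    ≡⟨ cong₂ _++_ (commute v (ins vs (u ∷ us))) (commute u (ins (v ∷ vs) us)) ⟩
  map (map f) (map (v ∷_) (ins vs (u ∷ us))) ++ map (map f) (map (u ∷_) (ins (v ∷ vs) us))
    ≡⟨ List.map-++ (map f) (map (v ∷_) (ins vs (u ∷ us))) _ ⟨
  map (map f) (ins (v ∷ vs) (u ∷ us)) ∎
  where
  open ≡-Reasoning
  commute : ∀ x ws → map (f x ∷_) (map (map f) ws) ≡ map (map f) (map (x ∷_) ws)
  commute x ws = trans (sym (List.map-∘ ws)) (List.map-∘ ws)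

-- A shuffle keeps the order within each word but may put a letter of either word first. As `R` need
-- not be symmetric, the relations between the two words are required in both directions.
ins-AllPairs : ∀ {ℓ} {R : Rel A ℓ} {vs us} → AllPairs R vs → AllPairs R us →
               All (λ v → All (R v) us) vs → All (λ u → All (R u) vs) us →
               ∀ {z} → z ∈ ins vs us → AllPairs R z
ins-AllPairs {vs = []}     {us}     _  Rus _ _ (here refl) = Rus
ins-AllPairs {vs = v ∷ vs} {[]}     Rvs _ _ _ (here refl) = Rvs
ins-AllPairs {vs = v ∷ vs} {u ∷ us} (v∼vs ∷ Rvs) (u∼us ∷ Rus) (v∼us ∷ vs∼us) (u∼vs ∷ us∼vs) z∈
  with ∈-++⁻ (map (v ∷_) (ins vs (u ∷ us))) z∈
... | inj₁ z∈l with _ , w∈ , refl ← ∈-map⁻ (v ∷_) z∈l =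
  ↭.All-resp-↭ (↭-sym (ins-↭ vs (u ∷ us) w∈)) (All.++⁺ v∼vs v∼us)
  ∷ ins-AllPairs Rvs (u∼us ∷ Rus) vs∼us (All.map All.tail (u∼vs ∷ us∼vs)) w∈
... | inj₂ z∈r with _ , w∈ , refl ← ∈-map⁻ (u ∷_) z∈r =
  ↭.All-resp-↭ (↭-sym (ins-↭ (v ∷ vs) us w∈)) (All.++⁺ u∼vs u∼us)
  ∷ ins-AllPairs (v∼vs ∷ Rvs) Rus (All.map All.tail (v∼us ∷ vs∼us)) us∼vs w∈

module Sums {c ℓ} (S : CommutativeRing c ℓ) where
  open CommutativeRing S renaming (_≈_ to _∼_; refl to ∼-refl; sym to ∼-sym; trans to ∼-trans)
  open import Relation.Binary.Reasoning.Setoid setoid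
  open import Algebra.Solver.CommutativeMonoid +-commutativeMonoid
    using (solve; _⊕_; _⊜_)

  ⨁ : List A → (A → Carrier) → Carrier
  ⨁ xs f = foldr (λ x s → f x + s) 0# xs

  ⨁-cong : ∀ (xs : List A) {f g} → (∀ {x} → x ∈ xs → f x ∼ g x) → ⨁ xs f ∼ ⨁ xs g
  ⨁-cong []       f∼g = ∼-refl
  ⨁-cong (x ∷ xs) f∼g = +-cong (f∼g (here refl)) (⨁-cong xs (f∼g ∘ there))

  ⨁-≡ : ∀ {xs ys : List A} {f} → xs ≡ ys → ⨁ xs f ∼ ⨁ ys f
  ⨁-≡ refl = ∼-refl

  ⨁-[_] : ∀ (x : A) f → ⨁ (x ∷ []) f ∼ f x
  ⨁-[ x ] f = +-identityʳ (f x)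

  ⨁-zero : ∀ (xs : List A) {f} → (∀ {x} → x ∈ xs → f x ∼ 0#) → ⨁ xs f ∼ 0#
  ⨁-zero []       f∼0 = ∼-refl
  ⨁-zero (x ∷ xs) f∼0 =
    ∼-trans (+-cong (f∼0 (here refl)) (⨁-zero xs (f∼0 ∘ there))) (+-identityˡ 0#)

  ⨁-++ : ∀ (xs ys : List A) f → ⨁ (xs ++ ys) f ∼ ⨁ xs f + ⨁ ys f
  ⨁-++ []       ys f = ∼-sym (+-identityˡ _)
  ⨁-++ (x ∷ xs) ys f = ∼-trans (+-congˡ (⨁-++ xs ys f)) (∼-sym (+-assoc _ _ _))

  ⨁-map : ∀ (h : A → B) xs f → ⨁ (map h xs) f ∼ ⨁ xs (f ∘ h)
  ⨁-map h []       f = ∼-refl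
  ⨁-map h (x ∷ xs) f = +-congˡ (⨁-map h xs f)

  ⨁-concatMap : ∀ (h : A → List B) xs f → ⨁ (concatMap h xs) f ∼ ⨁ xs (λ x → ⨁ (h x) f)
  ⨁-concatMap h []       f = ∼-refl
  ⨁-concatMap h (x ∷ xs) f =
    ∼-trans (⨁-++ (h x) (concatMap h xs) f) (+-congˡ (⨁-concatMap h xs f))

  ⨁-+ : ∀ (xs : List A) f g → ⨁ xs (λ x → f x + g x) ∼ ⨁ xs f + ⨁ xs g
  ⨁-+ []       f g = ∼-sym (+-identityˡ 0#)
  ⨁-+ (x ∷ xs) f g = ∼-trans (+-congˡ (⨁-+ xs f g))
    (solve 4 (λ a b c d → (a ⊕ b) ⊕ (c ⊕ d) ⊜ (a ⊕ c) ⊕ (b ⊕ d)) ∼-refl (f x) (g x) _ _)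

  ⨁-*ˡ : ∀ a (xs : List A) f → a * ⨁ xs f ∼ ⨁ xs (λ x → a * f x)
  ⨁-*ˡ a []       f = zeroʳ a
  ⨁-*ˡ a (x ∷ xs) f = ∼-trans (distribˡ a _ _) (+-congˡ (⨁-*ˡ a xs f))

  ⨁-swap : ∀ (xs : List A) (ys : List B) (f : A → B → Carrier) →
           ⨁ xs (λ x → ⨁ ys (f x)) ∼ ⨁ ys (λ y → ⨁ xs (λ x → f x y))
  ⨁-swap []       ys f = ∼-sym (⨁-zero ys (λ _ → ∼-refl))
  ⨁-swap (x ∷ xs) ys f =
    ∼-trans (+-congˡ (⨁-swap xs ys f)) (∼-sym (⨁-+ ys (f x) _))

  ⨁-filter : ∀ {p} {P : Pred A p} (P? : Decidable P) xs f →
             ⨁ (filter P? xs) f ∼ ⨁ xs (λ x → if does (P? x) then f x else 0#)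
  ⨁-filter P? []       f = ∼-refl
  ⨁-filter P? (x ∷ xs) f with does (P? x)
  ... | true  = +-congˡ (⨁-filter P? xs f)
  ... | false = ∼-trans (⨁-filter P? xs f) (∼-sym (+-identityˡ _))

  ⨁-↭ : ∀ {xs ys : List A} f → xs ↭ ys → ⨁ xs f ∼ ⨁ ys f
  ⨁-↭ f refl↭          = ∼-refl
  ⨁-↭ f (prep↭ x p)    = +-congˡ (⨁-↭ f p)
  ⨁-↭ f (swap↭ x y p)  = ∼-trans (+-congˡ (+-congˡ (⨁-↭ f p)))
    (solve 3 (λ a b c → a ⊕ (b ⊕ c) ⊜ b ⊕ (a ⊕ c)) ∼-refl (f x) (f y) _)
  ⨁-↭ f (trans↭ p r)   = ∼-trans (⨁-↭ f p) (⨁-↭ f r)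

  -- The bijections of words with words and with tableaux enter the sums through this lemma: it
  -- remains to show that the lists are free of repetitions and have the same members.
  ⨁-set : ∀ {xs ys : List A} f → Unique xs → Unique ys →
          (∀ {z} → z ∈ xs → z ∈ ys) → (∀ {z} → z ∈ ys → z ∈ xs) → ⨁ xs f ∼ ⨁ ys f
  ⨁-set f xs! ys! to from = ⨁-↭ f (∼bag⇒↭ (unique∧set⇒bag xs! ys! (mk⇔ to from)))

  ⨁-ins : ∀ (x : A) xs y ys f →
    ⨁ (ins (x ∷ xs) (y ∷ ys)) f ∼
    ⨁ (ins xs (y ∷ ys)) (f ∘ (x ∷_)) + ⨁ (ins (x ∷ xs) ys) (f ∘ (y ∷_))
  ⨁-ins x xs y ys f = ∼-trans (⨁-++ (map (x ∷_) (ins xs (y ∷ ys))) _ f)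
    (+-cong (⨁-map (x ∷_) (ins xs (y ∷ ys)) f) (⨁-map (y ∷_) (ins (x ∷ xs) ys) f))

  module _ {A : Set} where
    private
      left right : (as bs cs : List A) → (List A → Carrier) → Carrier
      left  as bs cs g = ⨁ (ins as bs) λ w → ⨁ (ins w cs) g
      right as bs cs g = ⨁ (ins bs cs) λ w → ⨁ (ins as w) g

      -- The first letter of a shuffle of three words comes from one of the three. `right-∷` obtains
      -- the same recursion for the other bracketing.
      left-∷ : ∀ a as b bs c cs g → left (a ∷ as) (b ∷ bs) (c ∷ cs) g ∼
        left as (b ∷ bs) (c ∷ cs) (g ∘ (a ∷_)) + left (a ∷ as) bs (c ∷ cs) (g ∘ (b ∷_))
        + left (a ∷ as) (b ∷ bs) cs (g ∘ (c ∷_))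
      left-∷ a as b bs c cs g = begin
        left (a ∷ as) (b ∷ bs) (c ∷ cs) g
          ≈⟨ ⨁-ins a as b bs _ ⟩
        ⨁ (ins as (b ∷ bs)) (λ w → ⨁ (ins (a ∷ w) (c ∷ cs)) g) +
        ⨁ (ins (a ∷ as) bs) (λ w → ⨁ (ins (b ∷ w) (c ∷ cs)) g)
          ≈⟨ +-cong (expand a (ins as (b ∷ bs))) (expand b (ins (a ∷ as) bs)) ⟩
        (left as (b ∷ bs) (c ∷ cs) (g ∘ (a ∷_)) +
         ⨁ (ins as (b ∷ bs)) (λ w → ⨁ (ins (a ∷ w) cs) (g ∘ (c ∷_)))) +
        (left (a ∷ as) bs (c ∷ cs) (g ∘ (b ∷_)) +
         ⨁ (ins (a ∷ as) bs) (λ w → ⨁ (ins (b ∷ w) cs) (g ∘ (c ∷_))))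
          ≈⟨ solve 4 (λ x y z w → (x ⊕ y) ⊕ (z ⊕ w) ⊜ (x ⊕ z) ⊕ (y ⊕ w)) ∼-refl _ _ _ _ ⟩
        left as (b ∷ bs) (c ∷ cs) (g ∘ (a ∷_)) + left (a ∷ as) bs (c ∷ cs) (g ∘ (b ∷_)) +
        (⨁ (ins as (b ∷ bs)) (λ w → ⨁ (ins (a ∷ w) cs) (g ∘ (c ∷_))) +
         ⨁ (ins (a ∷ as) bs) (λ w → ⨁ (ins (b ∷ w) cs) (g ∘ (c ∷_))))
          ≈⟨ +-congˡ (⨁-ins a as b bs _) ⟨
        left as (b ∷ bs) (c ∷ cs) (g ∘ (a ∷_)) + left (a ∷ as) bs (c ∷ cs) (g ∘ (b ∷_)) +
        left (a ∷ as) (b ∷ bs) cs (g ∘ (c ∷_)) ∎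
        where
        expand : ∀ x ws → ⨁ ws (λ w → ⨁ (ins (x ∷ w) (c ∷ cs)) g) ∼
          ⨁ ws (λ w → ⨁ (ins w (c ∷ cs)) (g ∘ (x ∷_))) +
          ⨁ ws (λ w → ⨁ (ins (x ∷ w) cs) (g ∘ (c ∷_)))
        expand x ws = ∼-trans (⨁-cong ws (λ {w} _ → ⨁-ins x w c cs g)) (⨁-+ ws _ _)

      right-∷ : ∀ a as b bs c cs g → right (a ∷ as) (b ∷ bs) (c ∷ cs) g ∼
        right as (b ∷ bs) (c ∷ cs) (g ∘ (a ∷_)) + right (a ∷ as) bs (c ∷ cs) (g ∘ (b ∷_))
        + right (a ∷ as) (b ∷ bs) cs (g ∘ (c ∷_))
      right-∷ a as b bs c cs g = begin
        right (a ∷ as) (b ∷ bs) (c ∷ cs) g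
          ≈⟨ ⨁-ins b bs c cs _ ⟩
        ⨁ (ins bs (c ∷ cs)) (λ w → ⨁ (ins (a ∷ as) (b ∷ w)) g) +
        ⨁ (ins (b ∷ bs) cs) (λ w → ⨁ (ins (a ∷ as) (c ∷ w)) g)
          ≈⟨ +-cong (expand b (ins bs (c ∷ cs))) (expand c (ins (b ∷ bs) cs)) ⟩
        (⨁ (ins bs (c ∷ cs)) (λ w → ⨁ (ins as (b ∷ w)) (g ∘ (a ∷_))) +
         right (a ∷ as) bs (c ∷ cs) (g ∘ (b ∷_))) +
        (⨁ (ins (b ∷ bs) cs) (λ w → ⨁ (ins as (c ∷ w)) (g ∘ (a ∷_))) +
         right (a ∷ as) (b ∷ bs) cs (g ∘ (c ∷_)))
          ≈⟨ solve 4 (λ x y z w → (x ⊕ y) ⊕ (z ⊕ w) ⊜ ((x ⊕ z) ⊕ y) ⊕ w) ∼-refl _ _ _ _ ⟩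
        (⨁ (ins bs (c ∷ cs)) (λ w → ⨁ (ins as (b ∷ w)) (g ∘ (a ∷_))) +
         ⨁ (ins (b ∷ bs) cs) (λ w → ⨁ (ins as (c ∷ w)) (g ∘ (a ∷_)))) +
        right (a ∷ as) bs (c ∷ cs) (g ∘ (b ∷_)) +
        right (a ∷ as) (b ∷ bs) cs (g ∘ (c ∷_))
          ≈⟨ +-congʳ (+-congʳ (⨁-ins b bs c cs _)) ⟨
        right as (b ∷ bs) (c ∷ cs) (g ∘ (a ∷_)) + right (a ∷ as) bs (c ∷ cs) (g ∘ (b ∷_)) +
        right (a ∷ as) (b ∷ bs) cs (g ∘ (c ∷_)) ∎
        where
        expand : ∀ x ws → ⨁ ws (λ w → ⨁ (ins (a ∷ as) (x ∷ w)) g) ∼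
          ⨁ ws (λ w → ⨁ (ins as (x ∷ w)) (g ∘ (a ∷_))) +
          ⨁ ws (λ w → ⨁ (ins (a ∷ as) w) (g ∘ (x ∷_)))
        expand x ws = ∼-trans (⨁-cong ws (λ {w} _ → ⨁-ins a as x w g)) (⨁-+ ws _ _)

    -- Associativity of the shuffle product. It is stated for sums because the two bracketings list
    -- the shuffles in different orders.
    ins-assoc : ∀ as bs cs (g : List A → Carrier) →
      ⨁ (ins as bs) (λ w → ⨁ (ins w cs) g) ∼ ⨁ (ins bs cs) (λ w → ⨁ (ins as w) g)
    ins-assoc [] bs cs g = ∼-trans (⨁-[ bs ] λ w → ⨁ (ins w cs) g)
      (∼-sym (⨁-cong (ins bs cs) (λ {w} _ → ⨁-[ w ] g)))
    ins-assoc (a ∷ as) [] cs g = ∼-trans (⨁-[ a ∷ as ] λ w → ⨁ (ins w cs) g)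
      (∼-sym (⨁-[ cs ] λ w → ⨁ (ins (a ∷ as) w) g))
    ins-assoc (a ∷ as) (b ∷ bs) [] g = ∼-trans
      (⨁-cong (ins (a ∷ as) (b ∷ bs)) (λ {w} _ → ∼-trans (⨁-≡ (ins-[]ʳ w)) (⨁-[ w ] g)))
      (∼-sym (⨁-[ b ∷ bs ] λ w → ⨁ (ins (a ∷ as) w) g))
    ins-assoc (a ∷ as) (b ∷ bs) (c ∷ cs) g = begin
      left (a ∷ as) (b ∷ bs) (c ∷ cs) g
        ≈⟨ left-∷ a as b bs c cs g ⟩
      _
        ≈⟨ +-cong (+-cong (ins-assoc as (b ∷ bs) (c ∷ cs) _) (ins-assoc (a ∷ as) bs (c ∷ cs) _))
                  (ins-assoc (a ∷ as) (b ∷ bs) cs _) ⟩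
      _
        ≈⟨ right-∷ a as b bs c cs g ⟨
      right (a ∷ as) (b ∷ bs) (c ∷ cs) g ∎

run : ℕ → ℕ → List ℕ
run y zero    = []
run y (suc m) = y ∷ run (suc y) m

-- The words of content b₁, …, b_N for the reversed list b = b_N, …, b₁.
arr : List ℕ → List (List ℕ)
arr []      = [] ∷ []
arr (p ∷ b) = concatMap (λ v → ins v (replicate p (length b))) (arr b)

run-≥ : ∀ y m → All (y ≤_) (run y m)
run-≥ y zero    = []
run-≥ y (suc m) = ℕ.≤-refl ∷ All.map (ℕ.≤-trans (ℕ.n≤1+n y)) (run-≥ (suc y) m)

arr-< : ∀ b {v} → v ∈ arr b → All (_< length b) v
arr-< []      (here refl) = []
arr-< (p ∷ b) v∈ with w , w∈ , v∈′ ← find (∈-concatMap⁻ _ {xs = arr b} v∈) =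
  ↭.All-resp-↭ (↭-sym (ins-↭ w _ v∈′))
    (All.++⁺ (All.map ℕ.m<n⇒m<1+n (arr-< b w∈)) (All.replicate⁺ p (ℕ.n<1+n (length b))))

-- Detection of the hook coefficient

Agree : ℕ × ℕ → ℕ × ℕ → Set
Agree (x , x′) (y , y′) = (x < y → x′ < y′) × (x′ < y′ → x < y)

module Detection {c ℓ} (S : CommutativeRing c ℓ) where
  open CommutativeRing S using (Carrier; _+_; +-congˡ; setoid; +-group)
    renaming (_≈_ to _∼_; sym to ∼-sym; trans to ∼-trans)
  open import Relation.Binary.Reasoning.Setoid setoid
  open import Algebra.Properties.Group +-group using (∙-cancelʳ)
  open Sums S

  -- Equivalently, g depends only on the standardisation of the word, in which
  -- equal letters increase from right to left.
  StdInvariant : (List ℕ → Carrier) → Set ℓ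
  StdInvariant g = ∀ zs → AllPairs Agree zs → g (map proj₁ zs) ∼ g (map proj₂ zs)

  -- This is R(b, p, m). The `length b` at the head of the second factor is the copy of the repeated
  -- letter that precedes all letters of the run.
  firstMin : List ℕ → ℕ → ℕ → (List ℕ → Carrier) → Carrier
  firstMin b p m g = ⨁ (arr b) λ v →
    ⨁ (ins (replicate p (length b)) (run (suc (length b)) m)) λ u →
    ⨁ (ins v (length b ∷ u)) g

  -- The counterpart of pairing with `h_b e_m`: the `m` largest letters are constrained only among
  -- themselves.
  increasing : List ℕ → ℕ → (List ℕ → Carrier) → Carrier
  increasing b m g = ⨁ (arr b) λ v → ⨁ (ins v (run (length b) m)) g

  increasing-suc : ∀ b m g → increasing b (suc m) g ∼ firstMin b 0 m g
  increasing-suc b m g = ⨁-cong (arr b) λ {v} _ →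
    ∼-sym (⨁-[ run (suc (length b)) m ] λ u → ⨁ (ins v (length b ∷ u)) g)

  -- Reassociating collects all letters from `length b` upwards in one factor `u`, whose first
  -- letter can then be examined.
  increasing-∷ : ∀ b p m g → increasing (p ∷ b) m g ∼
    ⨁ (arr b) λ v → ⨁ (ins (replicate p (length b)) (run (suc (length b)) m)) λ u → ⨁ (ins v u) g
  increasing-∷ b p m g = ∼-trans (⨁-concatMap _ (arr b) _)
    (⨁-cong (arr b) λ {v} _ → ins-assoc v (replicate p (length b)) (run (suc (length b)) m) g)

  increasing-zero : ∀ b p g → increasing (suc p ∷ b) 0 g ∼ firstMin b p 0 g
  increasing-zero b p g = ∼-trans (increasing-∷ b (suc p) 0 g) (⨁-cong (arr b) λ {v} _ →
    ∼-trans (⨁-[ replicate (suc p) (length b) ] λ u → ⨁ (ins v u) g)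
      (∼-sym (∼-trans (⨁-≡ (ins-[]ʳ (replicate p (length b))))
        (⨁-[ replicate p (length b) ] λ u → ⨁ (ins v (length b ∷ u)) g))))

  module _ (N : ℕ) where
    -- How the remaining letters are renamed when a letter `N + 1` is split off from the copies of
    -- `N`.
    up : ℕ → ℕ
    up y with N ℕ.<? y
    ... | yes _ = suc y
    ... | no  _ = y

    up-≡ : up N ≡ N
    up-≡ with N ℕ.<? N
    ... | yes N<N = contradiction N<N (ℕ.n≮n N)
    ... | no  _   = refl

    up-> : ∀ {y} → N < y → up y ≡ suc y
    up-> {y} N<y with N ℕ.<? y
    ... | yes _   = refl
    ... | no  N≮y = contradiction N<y N≮y

    up-≤ : ∀ {y} → N ≤ y → y ≤ up y
    up-≤ {y} _ with N ℕ.<? y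
    ... | yes _ = ℕ.n≤1+n y
    ... | no  _ = ℕ.≤-refl

    up-agree : ∀ x y → Agree (up x , x) (up y , y)
    up-agree x y with N ℕ.<? x | N ℕ.<? y
    ... | yes _   | yes _   = ℕ.s<s⁻¹ , ℕ.s<s
    ... | yes N<x | no  N≮y = (λ x<y → ℕ.<-trans (ℕ.n<1+n x) x<y)
                            , (λ x<y → contradiction (ℕ.<-trans N<x x<y) N≮y)
    ... | no  N≮x | yes N<y = (λ _ → ℕ.≤-<-trans (ℕ.≮⇒≥ N≮x) N<y)
                            , (λ x<y → ℕ.<-trans x<y (ℕ.n<1+n y))
    ... | no  _   | no  _   = id , id

    up-agree-suc : ∀ y → Agree (suc N , N) (up y , y)
    up-agree-suc y with N ℕ.<? y
    ... | yes N<y = (λ _ → N<y) , (λ _ → ℕ.s<s N<y)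
    ... | no  N≮y = (λ N<y → ℕ.<-trans (ℕ.n<1+n N) N<y) , (λ N<y → contradiction N<y N≮y)

    map-up-run : ∀ y m → N < y → map up (run y m) ≡ run (suc y) m
    map-up-run y zero    N<y = refl
    map-up-run y (suc m) N<y = cong₂ _∷_ (up-> N<y) (map-up-run (suc y) m (ℕ.m<n⇒m<1+n N<y))

    map-up-ins : ∀ p m → ins (replicate p N) (run (suc (suc N)) m) ≡
                         map (map up) (ins (replicate p N) (run (suc N) m))
    map-up-ins p m = trans
      (cong₂ ins (sym (trans (List.map-replicate up p N) (cong (replicate p) up-≡)))
                 (sym (map-up-run (suc N) m (ℕ.n<1+n N))))
      (map-ins up (replicate p N) (run (suc N) m))

    -- Lowering the letter N + 1 in front to N, and the letters above it by one,
    -- keeps the standardisation, since that letter stands before every N.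
    ins-collapse : ∀ {g} → StdInvariant g → ∀ {v u} → All (_< N) v → All (N ≤_) u →
                   ⨁ (ins v (suc N ∷ map up u)) g ∼ ⨁ (ins v (N ∷ u)) g
    ins-collapse {g} inv {v} {u} v<N u≥N = begin
      ⨁ (ins v (suc N ∷ map up u)) g
        ≈⟨ ⨁-≡ (image proj₁ (trans (sym (List.map-∘ v)) (List.map-id v))
                            (cong (suc N ∷_) (sym (List.map-∘ u)))) ⟨
      ⨁ (map (map proj₁) zss) g
        ≈⟨ ⨁-map (map proj₁) zss g ⟩
      ⨁ zss (g ∘ map proj₁)
        ≈⟨ ⨁-cong zss (λ {zs} zs∈ → inv zs
             (ins-AllPairs vv uu (All.map⁺ (All.map vu v<N)) uv zs∈)) ⟩
      ⨁ zss (g ∘ map proj₂)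
        ≈⟨ ⨁-map (map proj₂) zss g ⟨
      ⨁ (map (map proj₂) zss) g
        ≈⟨ ⨁-≡ (image proj₂ (trans (sym (List.map-∘ v)) (List.map-id v))
                            (cong (N ∷_) (trans (sym (List.map-∘ u)) (List.map-id u)))) ⟩
      ⨁ (ins v (N ∷ u)) g ∎
      where
      -- Every letter is paired with its lowered value. Shuffling the pairs once and projecting
      -- gives both sums, and `Agree` compares the two projections.
      vs = map (λ x → x , x) v
      us = (suc N , N) ∷ map (λ y → up y , y) u
      zss = ins vs us

      image : ∀ (f : ℕ × ℕ → ℕ) {v′ u′} → map f vs ≡ v′ → map f us ≡ u′ →
              map (map f) zss ≡ ins v′ u′
      image f refl refl = sym (map-ins f vs us)

      vv : AllPairs Agree vs
      vv = AllPairs.map⁺ (pairs v)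
        where
        pairs : ∀ v → AllPairs (λ x y → Agree (x , x) (y , y)) v
        pairs []      = []
        pairs (x ∷ v) = All.universal (λ _ → id , id) v ∷ pairs v

      uu : AllPairs Agree us
      uu = All.map⁺ (All.universal up-agree-suc u) ∷ AllPairs.map⁺ (pairs u)
        where
        pairs : ∀ u → AllPairs (λ x y → Agree (up x , x) (up y , y)) u
        pairs []      = []
        pairs (x ∷ u) = All.universal (up-agree x) u ∷ pairs u

      vu : ∀ {x} → x < N → All (Agree (x , x)) us
      vu x<N = ((λ _ → x<N) , (λ _ → ℕ.m<n⇒m<1+n x<N))
        ∷ All.map⁺ (All.map (λ N≤y → (λ _ → ℕ.<-≤-trans x<N N≤y)
                                   , (λ _ → ℕ.<-≤-trans x<N (ℕ.≤-trans N≤y (up-≤ N≤y)))) u≥N)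

      uv : All (λ y → All (Agree y) vs) us
      uv = All.map⁺ (All.map (λ x<N → (λ N<x → contradiction (ℕ.<-trans (ℕ.n<1+n N) N<x) (ℕ.<-asym x<N))
                                     , (λ N<x → contradiction N<x (ℕ.<-asym x<N))) v<N)
        ∷ All.map⁺ (All.map (λ {y} N≤y → All.map⁺ (All.map (λ {x} x<N →
              (λ y<x → contradiction (ℕ.<-≤-trans x<N (ℕ.≤-trans N≤y (up-≤ N≤y))) (ℕ.<-asym y<x))
            , (λ y<x → contradiction (ℕ.<-≤-trans x<N N≤y) (ℕ.<-asym y<x))) v<N)) u≥N)

  -- The Pieri rule. Among the letters from `x` upwards the run is increasing, so the first one is
  -- `x` or `x + 1`. If it is `x + 1`, it precedes every `x` and can be lowered to one more copy of
  -- `x`.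
  increasing-split : ∀ {g} → StdInvariant g → ∀ b p m →
    increasing (suc p ∷ b) (suc m) g ∼ firstMin b p (suc m) g + firstMin b (suc p) m g
  increasing-split {g} inv b p m = begin
    increasing (suc p ∷ b) (suc m) g
      ≈⟨ increasing-∷ b (suc p) (suc m) g ⟩
    ⨁ (arr b) (λ v → ⨁ (ins (x ∷ replicate p x) (suc x ∷ run (suc (suc x)) m)) λ u → ⨁ (ins v u) g)
      ≈⟨ ⨁-cong (arr b) (λ {v} v∈ → ∼-trans
           (⨁-ins x (replicate p x) (suc x) (run (suc (suc x)) m) λ u → ⨁ (ins v u) g)
           (+-congˡ (lower v∈))) ⟩
    ⨁ (arr b) (λ v → ⨁ (ins (replicate p x) (run (suc x) (suc m))) (λ u → ⨁ (ins v (x ∷ u)) g)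
                   + ⨁ (ins (replicate (suc p) x) (run (suc x) m)) (λ u → ⨁ (ins v (x ∷ u)) g))
      ≈⟨ ⨁-+ (arr b) _ _ ⟩
    firstMin b p (suc m) g + firstMin b (suc p) m g ∎
    where
    x = length b

    lower : ∀ {v} → v ∈ arr b →
      ⨁ (ins (replicate (suc p) x) (run (suc (suc x)) m)) (λ u → ⨁ (ins v (suc x ∷ u)) g) ∼
      ⨁ (ins (replicate (suc p) x) (run (suc x) m)) (λ u → ⨁ (ins v (x ∷ u)) g)
    lower {v} v∈ = ∼-trans (⨁-≡ (map-up-ins x (suc p) m))
      (∼-trans (⨁-map (map (up x)) (ins (replicate (suc p) x) (run (suc x) m)) _)
        (⨁-cong (ins (replicate (suc p) x) (run (suc x) m)) λ u∈ →
          ins-collapse x inv (arr-< b v∈)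
            (↭.All-resp-↭ (↭-sym (ins-↭ (replicate (suc p) x) (run (suc x) m) u∈))
              (All.++⁺ (All.replicate⁺ (suc p) ℕ.≤-refl)
                       (All.map (ℕ.≤-trans (ℕ.n≤1+n x)) (run-≥ (suc x) m))))))

  increasing-0 : ∀ b g → increasing b 0 g ∼ ⨁ (arr b) g
  increasing-0 b g = ⨁-cong (arr b) λ {v} _ → ∼-trans (⨁-≡ (ins-[]ʳ v)) (⨁-[ v ] g)

  -- Induction on `m` with `b` and `p` free. Of the three terms of the recursion two have the
  -- smaller `m`, so subtraction settles the third; at `m = 0` a full content class is left. The
  -- total degree `n` is the same throughout.
  firstMin-unique : ∀ {g h} → StdInvariant g → StdInvariant h → ∀ {n} →
    (∀ b → sum b ≡ n → ⨁ (arr b) g ∼ ⨁ (arr b) h) →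
    ∀ m b p → suc m ℕ.+ (p ℕ.+ sum b) ≡ n → firstMin b p m g ∼ firstMin b p m h
  firstMin-unique {g} {h} inv-g inv-h same zero b p eq = begin
    firstMin b p 0 g          ≈⟨ increasing-zero b p g ⟨
    increasing (suc p ∷ b) 0 g ≈⟨ increasing-0 (suc p ∷ b) g ⟩
    ⨁ (arr (suc p ∷ b)) g    ≈⟨ same (suc p ∷ b) eq ⟩
    ⨁ (arr (suc p ∷ b)) h    ≈⟨ increasing-0 (suc p ∷ b) h ⟨
    increasing (suc p ∷ b) 0 h ≈⟨ increasing-zero b p h ⟩
    firstMin b p 0 h          ∎
  firstMin-unique {g} {h} inv-g inv-h same (suc m) b p eq =
    ∙-cancelʳ (firstMin b (suc p) m g) _ _ (begin
    firstMin b p (suc m) g + firstMin b (suc p) m g  ≈⟨ increasing-split inv-g b p m ⟨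
    increasing (suc p ∷ b) (suc m) g                 ≈⟨ increasing-suc (suc p ∷ b) m g ⟩
    firstMin (suc p ∷ b) 0 m g
      ≈⟨ firstMin-unique inv-g inv-h same m (suc p ∷ b) 0 eq′ ⟩
    firstMin (suc p ∷ b) 0 m h                       ≈⟨ increasing-suc (suc p ∷ b) m h ⟨
    increasing (suc p ∷ b) (suc m) h                 ≈⟨ increasing-split inv-h b p m ⟩
    firstMin b p (suc m) h + firstMin b (suc p) m h
      ≈⟨ +-congˡ (firstMin-unique inv-g inv-h same m b (suc p) eq′) ⟨
    firstMin b p (suc m) h + firstMin b (suc p) m g  ∎)
    where
    eq′ : suc m ℕ.+ (suc p ℕ.+ sum b) ≡ _
    eq′ = trans (ℕ.+-suc (suc m) _) eq

-- Words of given content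

-- `h` recovers from an element the index that produced it, so different indices contribute disjoint
-- lists.
concatMap-unique : ∀ (f : A → List B) (h : B → A) {xs} → Unique xs →
  (∀ {x} → x ∈ xs → Unique (f x)) → (∀ {x y} → x ∈ xs → y ∈ f x → h y ≡ x) →
  Unique (concatMap f xs)
concatMap-unique f h []            f! hf = []
concatMap-unique f h {x ∷ xs} (x∉xs ∷ xs!) f! hf = Unique.++⁺ (f! (here refl))
  (concatMap-unique f h xs! (f! ∘ there) (hf ∘ there)) λ (y∈fx , y∈) →
    let x′ , x′∈ , y∈fx′ = find (∈-concatMap⁻ f {xs = xs} y∈) in
    All.All¬⇒¬Any x∉xs (subst (_∈ xs)
      (trans (sym (hf (there x′∈) y∈fx′)) (hf (here refl) y∈fx)) x′∈)

words-unique : ∀ {xs : List A} n → Unique xs → Unique (words xs n)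
words-unique zero    xs! = [] ∷ []
words-unique (suc n) xs! =
  Unique.cartesianProductWith⁺ _∷_ Vec.∷-injective xs! (words-unique n xs!)

∈-words : ∀ (v : Vec (Fin N) n) → v ∈ words (allFin N) n
∈-words []      = here refl
∈-words (i ∷ v) = ∈-cartesianProductWith⁺ _∷_ (∈-allFin i) (∈-words v)

toList-injective : ∀ {v w : Vec A n} → toList v ≡ toList w → v ≡ w
toList-injective {v = v} {w} eq = trans (sym (Vec.cast-is-id refl v)) (Vec.toList-injective refl v w eq)

ins-∷ˡ : ∀ (x : A) {z} vs us → z ∈ ins vs us → x ∷ z ∈ ins (x ∷ vs) us
ins-∷ˡ x vs []       z∈ with here refl ← subst (_ ∈_) (ins-[]ʳ vs) z∈ = here refl
ins-∷ˡ x vs (u ∷ us) z∈ = ∈-++⁺ˡ (∈-map⁺ (x ∷_) z∈)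

ins-∷ʳ : ∀ (x : A) {z} vs us → z ∈ ins vs us → x ∷ z ∈ ins vs (x ∷ us)
ins-∷ʳ x []       us (here refl) = here refl
ins-∷ʳ x (v ∷ vs) us z∈ = ∈-++⁺ʳ (map (v ∷_) (ins vs (x ∷ us))) (∈-map⁺ (x ∷_) z∈)

module _ {p} {Q : Pred A p} (Q? : Decidable Q) where
  ∈-ins-filter : ∀ z → z ∈ ins (filter (¬? ∘ Q?) z) (filter Q? z)
  ∈-ins-filter []      = here refl
  ∈-ins-filter (x ∷ z) with Q? x
  ... | yes _ = ins-∷ʳ x (filter (¬? ∘ Q?) z) (filter Q? z) (∈-ins-filter z)
  ... | no  _ = ins-∷ˡ x (filter (¬? ∘ Q?) z) (filter Q? z) (∈-ins-filter z)

  private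
    ¬¬-all : ∀ {us} → All Q us → All (λ x → ¬ ¬ Q x) us
    ¬¬-all = All.map λ q ¬q → ¬q q

  filter-ins : ∀ vs us {z} → All (¬_ ∘ Q) vs → All Q us → z ∈ ins vs us →
               filter (¬? ∘ Q?) z ≡ vs × filter Q? z ≡ us
  filter-ins []       us       _  Qus (here refl) =
    List.filter-none (¬? ∘ Q?) (¬¬-all Qus) , List.filter-all Q? Qus
  filter-ins (v ∷ vs) []       ¬Qvs _ (here refl) =
    List.filter-all (¬? ∘ Q?) ¬Qvs , List.filter-none Q? ¬Qvs
  filter-ins (v ∷ vs) (u ∷ us) (¬Qv ∷ ¬Qvs) (Qu ∷ Qus) z∈
    with ∈-++⁻ (map (v ∷_) (ins vs (u ∷ us))) z∈
  ... | inj₁ z∈l with _ , w∈ , refl ← ∈-map⁻ (v ∷_) z∈l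
                 with e , f ← filter-ins vs (u ∷ us) ¬Qvs (Qu ∷ Qus) w∈ =
    trans (List.filter-accept (¬? ∘ Q?) ¬Qv) (cong (v ∷_) e)
    , trans (List.filter-reject Q? ¬Qv) f
  ... | inj₂ z∈r with _ , w∈ , refl ← ∈-map⁻ (u ∷_) z∈r
                 with e , f ← filter-ins (v ∷ vs) us (¬Qv ∷ ¬Qvs) Qus w∈ =
    trans (List.filter-reject (¬? ∘ Q?) (λ ¬Qu → ¬Qu Qu)) e
    , trans (List.filter-accept Q? Qu) (cong (u ∷_) f)

  -- `Q` tells the letters of the two words apart, so the head of a shuffle reveals the word it was
  -- taken from.
  ins-unique : ∀ vs us → All (¬_ ∘ Q) vs → All Q us → Unique (ins vs us)
  ins-unique []       us       _            _          = [] ∷ []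
  ins-unique (v ∷ vs) []       _            _          = [] ∷ []
  ins-unique (v ∷ vs) (u ∷ us) (¬Qv ∷ ¬Qvs) (Qu ∷ Qus) = Unique.++⁺
    (Unique.map⁺ List.∷-injectiveʳ (ins-unique vs (u ∷ us) ¬Qvs (Qu ∷ Qus)))
    (Unique.map⁺ List.∷-injectiveʳ (ins-unique (v ∷ vs) us (¬Qv ∷ ¬Qvs) Qus))
    λ (z∈l , z∈r) → let _ , _ , e = ∈-map⁻ (v ∷_) z∈l ; _ , _ , f = ∈-map⁻ (u ∷_) z∈r in
      ¬Qv (subst Q (sym (List.∷-injectiveˡ (trans (sym e) f))) Qu)

count : ℕ → List ℕ → ℕ
count x z = length (filter (x ℕ.≟_) z)

count-↭ : ∀ x {z z′} → z ↭ z′ → count x z ≡ count x z′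
count-↭ x p = ↭.↭-length (↭.filter-↭ (x ℕ.≟_) p)

count-++ : ∀ x y z → count x (y ++ z) ≡ count x y ℕ.+ count x z
count-++ x y z = trans (cong length (List.filter-++ (x ℕ.≟_) y z)) (List.length-++ (filter (x ℕ.≟_) y))

count-none : ∀ x {z} → All (x ≢_) z → count x z ≡ 0
count-none x x∉z = cong length (List.filter-none (x ℕ.≟_) x∉z)

all-≡-replicate : ∀ {x : A} {xs} → All (_≡ x) xs → xs ≡ replicate (length xs) x
all-≡-replicate []         = refl
all-≡-replicate (refl ∷ e) = cong (_ ∷_) (all-≡-replicate e)

filter-≟ : ∀ x z → filter (x ℕ.≟_) z ≡ replicate (count x z) x
filter-≟ x z = all-≡-replicate (All.map sym (All.all-filter (x ℕ.≟_) z))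

-- As `b` is reversed, the head `p` belongs to the largest letter, which is the length of the tail.
multiplicity : List ℕ → ℕ → ℕ
multiplicity []      i = 0
multiplicity (p ∷ b) i = if does (i ℕ.≟ length b) then p else multiplicity b i

multiplicity-≡ : ∀ p b → multiplicity (p ∷ b) (length b) ≡ p
multiplicity-≡ p b rewrite dec-true (length b ℕ.≟ length b) refl = refl

multiplicity-≢ : ∀ p b {i} → i ≢ length b → multiplicity (p ∷ b) i ≡ multiplicity b i
multiplicity-≢ p b {i} i≢ rewrite dec-false (i ℕ.≟ length b) i≢ = refl

multiplicity-≥ : ∀ b {i} → length b ≤ i → multiplicity b i ≡ 0
multiplicity-≥ []      _   = refl
multiplicity-≥ (p ∷ b) b<i =
  trans (multiplicity-≢ p b (ℕ.>⇒≢ b<i)) (multiplicity-≥ b (ℕ.<⇒≤ b<i))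

count-ins : ∀ v {z} p {x i} → i ≢ x → z ∈ ins v (replicate p x) → count i z ≡ count i v
count-ins v {z} p {x} {i} i≢x z∈ = begin
  count i z                              ≡⟨ count-↭ i (ins-↭ v _ z∈) ⟩
  count i (v ++ replicate p x)           ≡⟨ count-++ i v _ ⟩
  count i v ℕ.+ count i (replicate p x)  ≡⟨ cong (count i v ℕ.+_) (count-none i (All.replicate⁺ p i≢x)) ⟩
  count i v ℕ.+ 0                        ≡⟨ ℕ.+-identityʳ _ ⟩
  count i v                              ∎
  where open ≡-Reasoning

arr-≢ : ∀ b {v} → v ∈ arr b → All (λ x → length b ≢ x) v
arr-≢ b v∈ = All.map ℕ.>⇒≢ (arr-< b v∈)

count-arr : ∀ b {z} → z ∈ arr b → ∀ i → count i z ≡ multiplicity b i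
count-arr []      (here refl) i = refl
count-arr (p ∷ b) {z} z∈ i with v , v∈ , z∈′ ← find (∈-concatMap⁻ _ {xs = arr b} z∈) | i ℕ.≟ length b
... | yes refl = begin
  length (filter (length b ℕ.≟_) z)   ≡⟨ cong length (proj₂ (filter-ins (length b ℕ.≟_) v _
                                           (arr-≢ b v∈) (All.replicate⁺ p refl) z∈′)) ⟩
  length (replicate p (length b))     ≡⟨ List.length-replicate p ⟩
  p                                   ≡⟨ multiplicity-≡ p b ⟨
  multiplicity (p ∷ b) (length b)     ∎
  where open ≡-Reasoning
... | no i≢ = trans (count-ins v p i≢ z∈′) (trans (count-arr b v∈ i) (sym (multiplicity-≢ p b i≢)))

-- Deleting the largest letter leaves a word of the content given by the tail, and every word is a
-- shuffle of the part that satisfies a predicate with the part that does not.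
∈-arr : ∀ b {z} → (∀ i → count i z ≡ multiplicity b i) → z ∈ arr b
∈-arr [] {[]}    _ = here refl
∈-arr [] {x ∷ z} e with () ← trans (sym (cong length (List.filter-accept (x ℕ.≟_) {xs = z} refl))) (e x)
∈-arr (p ∷ b) {z} e = ∈-concatMap⁺ (λ v → ins v (replicate p x)) (lose rest∈
  (subst (λ us → z ∈ ins rest us)
    (trans (filter-≟ x z) (cong (λ k → replicate k x) (trans (e x) (multiplicity-≡ p b)))) z∈))
  where
  x = length b
  rest = filter (¬? ∘ (x ℕ.≟_)) z
  z∈ = ∈-ins-filter (x ℕ.≟_) z

  rest∈ : rest ∈ arr b
  rest∈ = ∈-arr b count-rest
    where
    count-rest : ∀ i → count i rest ≡ multiplicity b i
    count-rest i with i ℕ.≟ x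
    ... | yes refl = trans (count-none x (All.all-filter (¬? ∘ (x ℕ.≟_)) z))
                           (sym (multiplicity-≥ b ℕ.≤-refl))
    ... | no i≢x = trans
      (sym (count-ins rest (count x z) i≢x (subst (λ us → z ∈ ins rest us) (filter-≟ x z) z∈)))
      (trans (e i) (multiplicity-≢ p b i≢x))

arr-unique : ∀ b → Unique (arr b)
arr-unique []      = [] ∷ []
arr-unique (p ∷ b) = concatMap-unique _ (filter (¬? ∘ (length b ℕ.≟_))) (arr-unique b)
  (λ v∈ → ins-unique (length b ℕ.≟_) _ _ (arr-≢ b v∈) (All.replicate⁺ p refl))
  (λ v∈ z∈ → proj₁ (filter-ins (length b ℕ.≟_) _ _ (arr-≢ b v∈) (All.replicate⁺ p refl) z∈))

length-arr : ∀ b {z} → z ∈ arr b → length z ≡ sum b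
length-arr []      (here refl) = refl
length-arr (p ∷ b) {z} z∈ with v , v∈ , z∈′ ← find (∈-concatMap⁻ _ {xs = arr b} z∈) = begin
  length z                                   ≡⟨ ↭.↭-length (ins-↭ v _ z∈′) ⟩
  length (v ++ replicate p (length b))       ≡⟨ List.length-++ v ⟩
  length v ℕ.+ length (replicate p (length b)) ≡⟨ cong₂ ℕ._+_ (length-arr b v∈) (List.length-replicate p) ⟩
  sum b ℕ.+ p                                ≡⟨ ℕ.+-comm (sum b) p ⟩
  p ℕ.+ sum b                                ∎
  where open ≡-Reasoning

exponents : (b : List ℕ) → Vec ℕ (length b)
exponents b = tabulate (multiplicity b ∘ toℕ)

-- The head of the reversed list is the last exponent, so an induction on the list has to peel the
-- vector from its end.
sum-tabulate-last : ∀ (f : ℕ → ℕ) N →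
  Vec.sum (tabulate {n = suc N} (f ∘ toℕ)) ≡ Vec.sum (tabulate {n = N} (f ∘ toℕ)) ℕ.+ f N
sum-tabulate-last f zero    = ℕ.+-comm (f 0) 0
sum-tabulate-last f (suc N) = trans (cong (f 0 ℕ.+_) (sum-tabulate-last (f ∘ suc) N))
  (sym (ℕ.+-assoc (f 0) _ _))

sum-exponents : ∀ b → Vec.sum (exponents b) ≡ sum b
sum-exponents []      = refl
sum-exponents (p ∷ b) = begin
  Vec.sum (exponents (p ∷ b))
    ≡⟨ sum-tabulate-last (multiplicity (p ∷ b)) (length b) ⟩
  Vec.sum (tabulate {n = length b} (multiplicity (p ∷ b) ∘ toℕ)) ℕ.+ multiplicity (p ∷ b) (length b)
    ≡⟨ cong₂ ℕ._+_ (cong Vec.sum (Vec.tabulate-cong λ i → multiplicity-≢ p b (ℕ.<⇒≢ (Fin.toℕ<n i))))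
                   (multiplicity-≡ p b) ⟩
  Vec.sum (exponents b) ℕ.+ p
    ≡⟨ cong (ℕ._+ p) (sum-exponents b) ⟩
  sum b ℕ.+ p
    ≡⟨ ℕ.+-comm (sum b) p ⟩
  p ℕ.+ sum b ∎
  where open ≡-Reasoning

count-toℕ : ∀ (i : Fin N) us → count (toℕ i) (map toℕ us) ≡ length (filter (i Fin.≟_) us)
count-toℕ i []       = refl
count-toℕ i (u ∷ us) with i Fin.≟ u
... | yes refl = trans (cong length (List.filter-accept (toℕ i ℕ.≟_) refl)) (cong suc (count-toℕ i us))
... | no  i≢u  = trans (cong length (List.filter-reject (toℕ i ℕ.≟_) (i≢u ∘ Fin.toℕ-injective)))
                       (count-toℕ i us)

content⇒count : ∀ b {us} → content us ≡ exponents b →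
                ∀ i → count i (map toℕ us) ≡ multiplicity b i
content⇒count b {us} e i with i ℕ.<? length b
... | yes i<N = begin
  count i (map toℕ us)              ≡⟨ cong (λ k → count k (map toℕ us)) (Fin.toℕ-fromℕ< i<N) ⟨
  count (toℕ j) (map toℕ us)        ≡⟨ count-toℕ j us ⟩
  length (filter (j Fin.≟_) us)     ≡⟨ Vec.lookup∘tabulate _ j ⟨
  lookup (content us) j             ≡⟨ cong (λ v → lookup v j) e ⟩
  lookup (exponents b) j            ≡⟨ Vec.lookup∘tabulate _ j ⟩
  multiplicity b (toℕ j)            ≡⟨ cong (multiplicity b) (Fin.toℕ-fromℕ< i<N) ⟩
  multiplicity b i                  ∎
  where
  open ≡-Reasoning
  j = fromℕ< i<N
... | no i≮N = trans (count-none i (All.map⁺ (All.universal (λ u i≡u →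
    i≮N (subst (_< length b) (sym i≡u) (Fin.toℕ<n u))) us)))
  (sym (multiplicity-≥ b (ℕ.≮⇒≥ i≮N)))

count⇒content : ∀ b {us} → (∀ i → count i (map toℕ us) ≡ multiplicity b i) →
                content us ≡ exponents b
count⇒content b {us} e = Vec.tabulate-cong λ i → trans (sym (count-toℕ i us)) (e (toℕ i))

fromℕs : ∀ {z} → All (_< N) z → Σ[ v ∈ Vec (Fin N) (length z) ] map toℕ (toList v) ≡ z
fromℕs []           = [] , refl
fromℕs (x<N ∷ z<N) = let v , e = fromℕs z<N in
  fromℕ< x<N ∷ v , cong₂ _∷_ (Fin.toℕ-fromℕ< x<N) e

module Words {c ℓ} (S : CommutativeRing c ℓ) where
  open CommutativeRing S using () renaming (_≈_ to _∼_; sym to ∼-sym; trans to ∼-trans)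
  open Sums S

  -- Passes from vectors over a fixed finite alphabet, in which `LLT` is defined, to lists of
  -- naturals, in which letters can be added and shifted.
  ⨁-words : ∀ b {n} → sum b ≡ n → ∀ g →
    ⨁ (filter (λ σ → content (toList σ) ≟ᵐ exponents b) (words (allFin (length b)) n))
      (λ σ → g (map toℕ (toList σ)))
    ∼ ⨁ (arr b) g
  ⨁-words b {n} b⊢n g = ∼-trans (∼-sym (⨁-map letters ws g))
    (⨁-set g (Unique.map⁺ (toList-injective ∘ List.map-injective Fin.toℕ-injective)
               (Unique.filter⁺ P? (words-unique n (Unique.allFin⁺ _))))
      (arr-unique b) to from)
    where
    letters : Vec (Fin (length b)) n → List ℕ
    letters σ = map toℕ (toList σ)
    P? = λ (σ : Vec (Fin (length b)) n) → content (toList σ) ≟ᵐ exponents b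
    ws = filter P? (words (allFin (length b)) n)

    to : ∀ {z} → z ∈ map letters ws → z ∈ arr b
    to z∈ with σ , σ∈ , refl ← ∈-map⁻ letters z∈ =
      ∈-arr b (content⇒count b {toList σ} (proj₂ (∈-filter⁻ P? {xs = words (allFin (length b)) n} σ∈)))

    from : ∀ {z} → z ∈ arr b → z ∈ map letters ws
    from {z} z∈ with refl ← trans (sym b⊢n) (sym (length-arr b z∈))
      with σ , e ← fromℕs (arr-< b z∈) = subst (_∈ map letters ws) e
        (∈-map⁺ letters (∈-filter⁺ P? (∈-words σ) (count⇒content b {toList σ} λ i →
          trans (cong (count i) e) (count-arr b z∈ i))))

-- Reading words of semistandard tableaux

AllPairs-reverse : ∀ {ℓ} {R : Rel A ℓ} {xs} → AllPairs R xs → AllPairs (flip R) (reverse xs)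
AllPairs-reverse {xs = []}     []         = []
AllPairs-reverse {R = R} {x ∷ xs} (Rx ∷ Rxs) = subst (AllPairs (flip R)) (sym (List.unfold-reverse x xs))
  (AllPairs.++⁺ (AllPairs-reverse Rxs) ([] ∷ [])
    (All.map (_∷ []) (↭.All-resp-↭ (↭-sym (↭.↭-reverse xs)) Rx)))

Linked-reverse⁻ : ∀ {xs} → Linked _≤_ (reverse xs) → AllPairs _≥_ xs
Linked-reverse⁻ {xs} l = subst (AllPairs _≥_) (List.reverse-involutive xs)
  (AllPairs-reverse (Linked.Linked⇒AllPairs ℕ.≤-trans l))

-- The left inverse is required on members only: a tableau is recovered from its reading word once
-- its shape is known.
map-unique : ∀ (f : A → B) (h : B → A) {xs} → (∀ {x} → x ∈ xs → h (f x) ≡ x) →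
             Unique xs → Unique (map f xs)
map-unique f h hf []           = []
map-unique f h hf (x∉xs ∷ xs!) =
  All.map⁺ (All.tabulate λ {y} y∈ fx≡fy → All.lookup x∉xs y∈
    (trans (sym (hf (here refl))) (trans (cong h fx≡fy) (hf (there y∈)))))
  ∷ map-unique f h (hf ∘ there) xs!

Semistandard : (A → ℕ) → List (List A) → Set
Semistandard f T = All (Linked λ x y → f x ≤ f y) T
                 × Linked (λ upper lower → Prefix (λ y x → f x < f y) lower upper) T

semistandard? : (f : A → ℕ) → Decidable (Semistandard f)
semistandard? f T = all? (linked? λ x y → f x ℕ.≤? f y) T
  ×-dec linked? (λ upper lower → Prefix.prefix? (λ y x → f x ℕ.<? f y) lower upper) T

semistandard-map⁺ : ∀ {f : A → ℕ} {T} → Semistandard f T → Semistandard id (map (map f) T)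
semistandard-map⁺ {f = f} (rows , columns) =
  All.map⁺ (All.map Linked.map⁺ rows) , Linked.map⁺ (Linked.map (Prefix.map⁺ f f) columns)

semistandard-map⁻ : ∀ {f : A → ℕ} {T} → Semistandard id (map (map f) T) → Semistandard f T
semistandard-map⁻ {f = f} (rows , columns) =
  All.map Linked.map⁻ (All.map⁻ rows) , Linked.map (Prefix.map⁻ f f) (Linked.map⁻ columns)

module _ {f g : A → ℕ} where
  private
    _≎_ : A → A → Set
    x ≎ y = (f x < f y → g x < g y) × (g x < g y → f x < f y)

  -- Rows are read from right to left, so the right neighbour is the earlier letter and the relation
  -- is flipped. Weak increase is the negation of a strict inequality from the earlier to the later
  -- letter.
  row-transfer : ∀ {r} → AllPairs (flip _≎_) r →
                 Linked (λ x y → f x ≤ f y) r → Linked (λ x y → g x ≤ g y) r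
  row-transfer _                  []       = []
  row-transfer _                  [-]      = [-]
  row-transfer ((y≎x ∷ _) ∷ rest) (x≤y ∷ l) =
    ℕ.≮⇒≥ (λ gy<gx → ℕ.≤⇒≯ x≤y (proj₂ y≎x gy<gx)) ∷ row-transfer rest l

  column-transfer : ∀ {upper lower} → All (λ x → All (x ≎_) lower) upper →
    Prefix (λ y x → f x < f y) lower upper → Prefix (λ y x → g x < g y) lower upper
  column-transfer _          []        = []
  column-transfer (x≎ ∷ xs≎) (x<y ∷ p) =
    proj₁ (All.head x≎) x<y ∷ column-transfer (All.map All.tail xs≎) p

  semistandard-transfer : ∀ {T} → All (AllPairs (flip _≎_)) T →
    AllPairs (λ upper lower → All (λ x → All (x ≎_) lower) upper) T →
    Semistandard f T → Semistandard g T
  semistandard-transfer {T} in-row across (rows , columns) =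
    All.zipWith (λ (p , l) → row-transfer p l) (in-row , rows) , go across columns
    where
    go : ∀ {T} → AllPairs (λ upper lower → All (λ x → All (x ≎_) lower) upper) T →
         Linked (λ upper lower → Prefix (λ y x → f x < f y) lower upper) T →
         Linked (λ upper lower → Prefix (λ y x → g x < g y) lower upper) T
    go _                []      = []
    go _                [-]     = [-]
    go ((p ∷ _) ∷ rest) (c ∷ l) = column-transfer p c ∷ go rest l

-- The reading order is chosen so that the entries of a semistandard tableau
-- standardise as the letters of a word: rows from top to bottom, each from right
-- to left.
readingWord : List (List A) → List A
readingWord T = concat (map reverse T)

-- Defined for words of every length, since invariance under standardisation is demanded of all
-- words. It inverts `readingWord` when the length is the size of the shape.
fromReading : List ℕ → List A → List (List A)
fromReading []       w = []
fromReading (k ∷ λs) w = reverse (take k w) ∷ fromReading λs (drop k w)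

take-length : ∀ (xs ys : List A) → take (length xs) (xs ++ ys) ≡ xs
take-length []       ys = refl
take-length (x ∷ xs) ys = cong (x ∷_) (take-length xs ys)

drop-length : ∀ (xs ys : List A) → drop (length xs) (xs ++ ys) ≡ ys
drop-length []       ys = refl
drop-length (x ∷ xs) ys = drop-length xs ys

fromReading-readingWord : ∀ (T : List (List A)) → fromReading (map length T) (readingWord T) ≡ T
fromReading-readingWord []      = refl
fromReading-readingWord (r ∷ T) rewrite sym (List.length-reverse r) =
  cong₂ _∷_
    (trans (cong reverse (take-length (reverse r) (readingWord T))) (List.reverse-involutive r))
    (trans (cong (fromReading (map length T)) (drop-length (reverse r) (readingWord T)))
           (fromReading-readingWord T))

length-drop-sum : ∀ k λs (w : List A) → length w ≡ k ℕ.+ sum λs → length (drop k w) ≡ sum λs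
length-drop-sum k λs w e = trans (List.length-drop k w) (trans (cong (ℕ._∸ k) e) (ℕ.m+n∸m≡n k _))

readingWord-fromReading : ∀ λs (w : List A) → length w ≡ sum λs → readingWord (fromReading λs w) ≡ w
readingWord-fromReading []       []  e = refl
readingWord-fromReading (k ∷ λs) w   e = trans
  (cong₂ _++_ (List.reverse-involutive (take k w))
    (readingWord-fromReading λs (drop k w) (length-drop-sum k λs w e)))
  (List.take++drop≡id k w)

shape-fromReading : ∀ λs (w : List A) → length w ≡ sum λs → map length (fromReading λs w) ≡ λs
shape-fromReading []       w e = refl
shape-fromReading (k ∷ λs) w e = cong₂ _∷_
  (trans (List.length-reverse (take k w)) (trans (List.length-take k w)
    (ℕ.m≤n⇒m⊓n≡m (subst (k ≤_) (sym e) (ℕ.m≤m+n k _)))))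
  (shape-fromReading λs (drop k w) (length-drop-sum k λs w e))

map-fromReading : ∀ (f : A → B) λs w → fromReading λs (map f w) ≡ map (map f) (fromReading λs w)
map-fromReading f []       w = refl
map-fromReading f (k ∷ λs) w = cong₂ _∷_
  (trans (cong reverse (List.take-map k w)) (sym (List.reverse-map f (take k w))))
  (trans (cong (fromReading λs) (List.drop-map k w)) (map-fromReading f λs (drop k w)))

readingWord-↭ : ∀ (T : List (List A)) → readingWord T ↭ concat T
readingWord-↭ []      = ↭-refl
readingWord-↭ (r ∷ T) = ↭.++⁺ (↭.↭-reverse r) (readingWord-↭ T)

All-fromReading : ∀ {p} {P : Pred A p} λs {w} → All P w → All (All P) (fromReading λs w)
All-fromReading []       _  = []
All-fromReading (k ∷ λs) {w} Pw = ↭.All-resp-↭ (↭-sym (↭.↭-reverse (take k w))) (All.take⁺ k Pw)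
  ∷ All-fromReading λs (All.drop⁺ k Pw)

module _ {ℓ} {R : Rel A ℓ} where
  AllPairs-take-drop : ∀ k {w} → AllPairs R w → All (λ x → All (R x) (drop k w)) (take k w)
  AllPairs-take-drop zero    _          = []
  AllPairs-take-drop (suc k) []         = []
  AllPairs-take-drop (suc k) (Rx ∷ Rw) = All.drop⁺ k Rx ∷ AllPairs-take-drop k Rw

  rows-AllPairs : ∀ λs {w} → AllPairs R w → All (AllPairs (flip R)) (fromReading λs w)
  rows-AllPairs []       _  = []
  rows-AllPairs (k ∷ λs) Rw =
    AllPairs-reverse (AllPairs.take⁺ k Rw) ∷ rows-AllPairs λs (AllPairs.drop⁺ k Rw)

  across-AllPairs : ∀ λs {w} → AllPairs R w →
    AllPairs (λ upper lower → All (λ x → All (R x) lower) upper) (fromReading λs w)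
  across-AllPairs []       _  = []
  across-AllPairs (k ∷ λs) {w} Rw =
    All.All-swap (↭.All-resp-↭ (↭-sym (↭.↭-reverse (take k w)))
      (All.map (All-fromReading λs) (AllPairs-take-drop k Rw)))
    ∷ across-AllPairs λs (AllPairs.drop⁺ k Rw)

-- The word of pairs itself is cut into a tableau. Each row or column condition asks whether the
-- earlier of two letters is smaller than the later one, which `Agree` carries from one projection
-- to the other.
semistandard-agree : ∀ λs {zs} → AllPairs Agree zs →
  Semistandard id (fromReading λs (map proj₁ zs)) → Semistandard id (fromReading λs (map proj₂ zs))
semistandard-agree λs {zs} agree s =
  subst (Semistandard id) (sym (map-fromReading proj₂ λs zs))
    (semistandard-map⁺ (semistandard-transfer (rows-AllPairs λs agree) (across-AllPairs λs agree)
      (semistandard-map⁻ (subst (Semistandard id) (map-fromReading proj₁ λs zs) s))))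

∈-fillings⁻ : ∀ λs {T : Tableau N} → T ∈ fillings λs N → map length T ≡ λs
∈-fillings⁻ []           (here refl) = refl
∈-fillings⁻ {N} (k ∷ λs) T∈
  with r , T′ , r∈ , T′∈ , refl ← ∈-cartesianProductWith⁻ _∷_ (map toList (words (allFin N) k)) (fillings λs N) T∈
  with v , _ , refl ← ∈-map⁻ toList r∈ = cong₂ _∷_ (Vec.length-toList v) (∈-fillings⁻ λs T′∈)

∈-fillings⁺ : ∀ (T : Tableau N) → T ∈ fillings (map length T) N
∈-fillings⁺ []      = here refl
∈-fillings⁺ (r ∷ T) = ∈-cartesianProductWith⁺ _∷_
  (subst (_∈ map toList (words (allFin _) (length r))) (Vec.toList∘fromList r)
    (∈-map⁺ toList (∈-words (Vec.fromList r))))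
  (∈-fillings⁺ T)

fillings-unique : ∀ λs N → Unique (fillings λs N)
fillings-unique []       N = [] ∷ []
fillings-unique (k ∷ λs) N = Unique.cartesianProductWith⁺ _∷_ List.∷-injective
  (Unique.map⁺ toList-injective (words-unique k (Unique.allFin⁺ N))) (fillings-unique λs N)

module SchurWords {c ℓ} (S : CommutativeRing c ℓ) where
  open CommutativeRing S using (Carrier; 0#; 1#; reflexive)
    renaming (_≈_ to _∼_; sym to ∼-sym; trans to ∼-trans)
  open Sums S
  open Detection S

  -- Turns a Schur function into a weight on words whose content sums are its coefficients, on the
  -- same footing as the LLT weight.
  isReadingWord : List ℕ → List ℕ → Carrier
  isReadingWord λs w = if does (semistandard? id (fromReading λs w)) then 1# else 0#

  isReadingWord-yes : ∀ λs w → Semistandard id (fromReading λs w) → isReadingWord λs w ≡ 1#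
  isReadingWord-yes λs w s = cong (if_then 1# else 0#) (dec-true (semistandard? id (fromReading λs w)) s)

  isReadingWord-no : ∀ λs w → ¬ Semistandard id (fromReading λs w) → isReadingWord λs w ≡ 0#
  isReadingWord-no λs w ¬s = cong (if_then 1# else 0#) (dec-false (semistandard? id (fromReading λs w)) ¬s)

  isReadingWord-invariant : ∀ λs → StdInvariant (isReadingWord λs)
  isReadingWord-invariant λs zs agree
    with semistandard? id (fromReading λs (map proj₁ zs))
  ... | yes s = reflexive (trans (isReadingWord-yes λs (map proj₁ zs) s)
    (sym (isReadingWord-yes λs (map proj₂ zs) (semistandard-agree λs agree s))))
  -- The same transfer with the two components exchanged.
  ... | no ¬s = reflexive (trans (isReadingWord-no λs (map proj₁ zs) ¬s) (sym (isReadingWord-no λs (map proj₂ zs) λ s → ¬s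
    (subst (Semistandard id ∘ fromReading λs) (sym (List.map-∘ zs))
      (semistandard-agree λs {map Product.swap zs} (AllPairs.map⁺ (AllPairs.map Product.swap agree))
        (subst (Semistandard id ∘ fromReading λs) (List.map-∘ zs) s))))))

  ⨁-schur : ∀ λs b → sum b ≡ sum λs →
    ⨁ (filter (λ T → content (concat T) ≟ᵐ exponents b) (SSYT λs (length b))) (λ _ → 1#)
    ∼ ⨁ (arr b) (isReadingWord λs)
  ⨁-schur λs b eq = ∼-trans (∼-sym (⨁-map enc Ts _)) (∼-trans
      (⨁-set _ Ts! (Unique.filter⁺ Q? (arr-unique b)) to from)
      (⨁-filter Q? (arr b) _))
    where
    M = length b
    enc : Tableau M → List ℕ
    enc T = map toℕ (readingWord T)
    P? = λ (T : Tableau M) → content (concat T) ≟ᵐ exponents b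
    Ts = filter P? (SSYT λs M)
    Q? = λ w → semistandard? id (fromReading λs w)

    ∈-Ts⁻ : ∀ {T} → T ∈ Ts → map length T ≡ λs × IsSSYT T × content (concat T) ≡ exponents b
    ∈-Ts⁻ T∈ with T∈′ , e ← ∈-filter⁻ P? {xs = SSYT λs M} T∈
             with T∈″ , s ← ∈-filter⁻ isSSYT? {xs = fillings λs M} T∈′ = ∈-fillings⁻ λs T∈″ , s , e

    Ts! : Unique (map enc Ts)
    Ts! = subst Unique (sym (List.map-∘ Ts)) (Unique.map⁺ (List.map-injective Fin.toℕ-injective)
      (map-unique readingWord (fromReading λs)
        (λ {T} T∈ → subst (λ μ → fromReading μ (readingWord T) ≡ T) (proj₁ (∈-Ts⁻ T∈)) (fromReading-readingWord T))
        (Unique.filter⁺ P? (Unique.filter⁺ isSSYT? (fillings-unique λs M)))))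

    to : ∀ {w} → w ∈ map enc Ts → w ∈ filter Q? (arr b)
    to w∈ with T , T∈ , refl ← ∈-map⁻ enc w∈ with refl , s , e ← ∈-Ts⁻ T∈ = ∈-filter⁺ Q?
      (∈-arr b λ i → trans (count-↭ i (↭.map⁺ toℕ (readingWord-↭ T)))
                           (content⇒count b {concat T} e i))
      (subst (Semistandard id) (sym (trans (map-fromReading toℕ λs (readingWord T))
          (cong (map (map toℕ)) (fromReading-readingWord T)))) (semistandard-map⁺ s))

    from : ∀ {w} → w ∈ filter Q? (arr b) → w ∈ map enc Ts
    from {w} w∈ with w∈′ , s ← ∈-filter⁻ Q? {xs = arr b} w∈ with σ , e ← fromℕs (arr-< b w∈′) =
      subst (_∈ map enc Ts) (trans (cong (map toℕ) enc-T) e) (∈-map⁺ enc (∈-filter⁺ P?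
        (∈-filter⁺ isSSYT? (subst (λ μ → T ∈ fillings μ M) (shape-fromReading λs _ len) (∈-fillings⁺ T))
          (semistandard-map⁻ (subst (Semistandard id)
            (trans (cong (fromReading λs) (sym e)) (map-fromReading toℕ λs (toList σ))) s)))
        (count⇒content b {concat T} λ i → begin
          count i (map toℕ (concat T))   ≡⟨ count-↭ i (↭.map⁺ toℕ (readingWord-↭ T)) ⟨
          count i (map toℕ (readingWord T)) ≡⟨ cong (count i) (trans (cong (map toℕ) enc-T) e) ⟩
          count i w                      ≡⟨ count-arr b w∈′ i ⟩
          multiplicity b i               ∎)))
      where
      open ≡-Reasoning
      T = fromReading λs (toList σ)
      len : length (toList σ) ≡ sum λs
      len = trans (Vec.length-toList σ) (trans (length-arr b w∈′) eq)
      enc-T : readingWord T ≡ toList σ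
      enc-T = readingWord-fromReading λs (toList σ) len

-- Hook words

run-> : ∀ y m → All (y <_) (run (suc y) m)
run-> y m = run-≥ (suc y) m

length-run : ∀ y m → length (run y m) ≡ m
length-run y zero    = refl
length-run y (suc m) = cong suc (length-run (suc y) m)

-- The words that occur in firstMin [] p m, without their first letter 0.
hookWords : ℕ → ℕ → List (List ℕ)
hookWords p m = ins (replicate p 0) (run 1 m)

zeros : ∀ p → All (λ x → ¬ 0 < x) (replicate p 0)
zeros p = All.replicate⁺ p (ℕ.n≮n 0)

hookWords-unique : ∀ p m → Unique (hookWords p m)
hookWords-unique p m = ins-unique (0 ℕ.<?_) _ _ (zeros p) (run-> 0 m)

hookWords-filter : ∀ {p m u} → u ∈ hookWords p m →
  filter (¬? ∘ (0 ℕ.<?_)) u ≡ replicate p 0 × filter (0 ℕ.<?_) u ≡ run 1 m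
hookWords-filter {p} {m} = filter-ins (0 ℕ.<?_) _ _ (zeros p) (run-> 0 m)

length-hookWords : ∀ {p m u} → u ∈ hookWords p m → length u ≡ p ℕ.+ m
length-hookWords {p} {m} u∈ = trans (↭.↭-length (ins-↭ (replicate p 0) (run 1 m) u∈))
  (trans (List.length-++ (replicate p 0)) (cong₂ ℕ._+_ (List.length-replicate p) (length-run 1 m)))

replicate++run∈hookWords : ∀ p m → replicate p 0 ++ run 1 m ∈ hookWords p m
replicate++run∈hookWords zero    m       = here refl
replicate++run∈hookWords (suc p) zero    = here (cong (0 ∷_) (List.++-identityʳ _))
replicate++run∈hookWords (suc p) (suc m) =
  ins-∷ˡ 0 (replicate p 0) (run 1 (suc m)) (replicate++run∈hookWords p (suc m))

-- The letters of a row are read from right to left. A row of two or more cells would therefore end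
-- in `y + 1, y` for some `y`, against weak increase.
increasing-columns : ∀ μ y m → All (0 <_) μ → sum μ ≡ m →
  All (Linked _≤_) (fromReading μ (run y m)) → μ ≡ replicate m 1
increasing-columns []       y m       _         refl _       = refl
increasing-columns (zero ∷ μ) y m (() ∷ _) _ _
increasing-columns (suc zero ∷ μ) y (suc m) (_ ∷ μ>0) eq (_ ∷ ls) =
  cong (1 ∷_) (increasing-columns μ (suc y) m μ>0 (ℕ.suc-injective eq) ls)
increasing-columns (suc (suc k) ∷ μ) y (suc (suc m)) _ eq (l ∷ _)
  with (sy≤y ∷ _) ∷ _ ← Linked-reverse⁻ {y ∷ suc y ∷ take k (run (suc (suc y)) m)} l =
  contradiction sy≤y (ℕ.n≮n y)

below-positive : ∀ r T → Linked (λ upper lower → Prefix (λ y x → x < y) lower upper) (r ∷ T) →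
                 All (All (0 <_)) T
below-positive r []      _       = []
below-positive r (s ∷ T) (c ∷ l) = positive c ∷ below-positive s T l
  where
  positive : ∀ {lower upper : List ℕ} → Prefix (λ y x → x < y) lower upper → All (0 <_) lower
  positive []        = []
  positive (x<y ∷ c) = ℕ.≤-<-trans z≤n x<y ∷ positive c

-- The letter 0 ends the first row, which therefore consists of zeros, and the
-- letters below it are positive, so that they are 1, …, m in this order.
hookWord-shape : ∀ {p m l μ u} → u ∈ hookWords p m → All (0 <_) μ → l ℕ.+ sum μ ≡ p ℕ.+ m →
  Semistandard id (fromReading (suc l ∷ μ) (0 ∷ u)) →
  suc l ∷ μ ≡ suc p ∷ replicate m 1 × u ≡ replicate p 0 ++ run 1 m
hookWord-shape {p} {m} {l} {μ} {u} u∈ μ>0 sum≡ ((row ∷ rows) , columns) =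
  cong₂ (λ a b → suc a ∷ b) l≡p (increasing-columns μ 1 m μ>0 sum-μ
    (subst (All (Linked _≤_) ∘ fromReading μ) drop≡ rows))
  , trans (sym (List.take++drop≡id l u)) (cong₂ _++_ take≡ drop≡)
  where
  open ≡-Reasoning
  first = take l u
  rest = drop l u

  first-zero : All (λ x → ¬ 0 < x) first
  first-zero with z ∷ _ ← Linked-reverse⁻ {0 ∷ first} row = All.map ℕ.≤⇒≯ z

  length-u : length u ≡ l ℕ.+ sum μ
  length-u = trans (length-hookWords {p} {m} u∈) (sym sum≡)

  rest-positive : All (0 <_) rest
  rest-positive = subst (All (0 <_))
    (readingWord-fromReading μ rest (length-drop-sum l μ u length-u))
    (↭.All-resp-↭ (↭-sym (readingWord-↭ (fromReading μ rest))) (All.concat⁺ (below-positive _ _ columns)))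

  u≡ : first ++ rest ≡ u
  u≡ = List.take++drop≡id l u

  take≡ : first ≡ replicate p 0
  take≡ = begin
    first                                   ≡⟨ List.++-identityʳ first ⟨
    first ++ []                             ≡⟨ cong₂ _++_ (List.filter-all Z? first-zero)
                                                 (List.filter-none Z? (All.map (λ 0<x ¬0<x → ¬0<x 0<x) rest-positive)) ⟨
    filter Z? first ++ filter Z? rest       ≡⟨ List.filter-++ Z? first rest ⟨
    filter Z? (first ++ rest)               ≡⟨ cong (filter Z?) u≡ ⟩
    filter Z? u                             ≡⟨ proj₁ (hookWords-filter {p} {m} u∈) ⟩
    replicate p 0                           ∎
    where Z? = ¬? ∘ (0 ℕ.<?_)

  drop≡ : rest ≡ run 1 m
  drop≡ = begin
    rest                                    ≡⟨ cong₂ _++_ (List.filter-none (0 ℕ.<?_) first-zero)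
                                                          (List.filter-all (0 ℕ.<?_) rest-positive) ⟨
    filter (0 ℕ.<?_) first ++ filter (0 ℕ.<?_) rest ≡⟨ List.filter-++ (0 ℕ.<?_) first rest ⟨
    filter (0 ℕ.<?_) (first ++ rest)        ≡⟨ cong (filter (0 ℕ.<?_)) u≡ ⟩
    filter (0 ℕ.<?_) u                      ≡⟨ proj₂ (hookWords-filter {p} {m} u∈) ⟩
    run 1 m                                 ∎

  l≡p : l ≡ p
  l≡p = begin
    l                        ≡⟨ ℕ.m≤n⇒m⊓n≡m (subst (l ≤_) (sym length-u) (ℕ.m≤m+n l (sum μ))) ⟨
    l ℕ.⊓ length u           ≡⟨ List.length-take l u ⟨
    length first             ≡⟨ cong length take≡ ⟩
    length (replicate p 0)   ≡⟨ List.length-replicate p ⟩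
    p                        ∎

  sum-μ : sum μ ≡ m
  sum-μ = ℕ.+-cancelˡ-≡ l (sum μ) m (trans sum≡ (cong (ℕ._+ m) (sym l≡p)))

hookWord-semistandard : ∀ p m →
  Semistandard id (fromReading (suc p ∷ replicate m 1) (0 ∷ replicate p 0 ++ run 1 m))
hookWord-semistandard p m = subst (Semistandard id)
  (sym (cong₂ _∷_ (cong reverse first≡) (trans (cong (fromReading (replicate m 1)) rest≡) (column≡ 1 m))))
  ((constant (suc p) ∷ All.map⁺ (All.universal (λ _ → [-]) (run 1 m))) , columns)
  where
  first≡ : take (suc p) (replicate (suc p) 0 ++ run 1 m) ≡ replicate (suc p) 0
  first≡ = trans (cong (λ k → take k (replicate (suc p) 0 ++ run 1 m)) (sym (List.length-replicate (suc p))))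
                 (take-length (replicate (suc p) 0) (run 1 m))

  rest≡ : drop (suc p) (replicate (suc p) 0 ++ run 1 m) ≡ run 1 m
  rest≡ = trans (cong (λ k → drop k (replicate (suc p) 0 ++ run 1 m)) (sym (List.length-replicate (suc p))))
                (drop-length (replicate (suc p) 0) (run 1 m))

  column≡ : ∀ y m → fromReading (replicate m 1) (run y m) ≡ map [_] (run y m)
  column≡ y zero    = refl
  column≡ y (suc m) = cong ([ y ] ∷_) (column≡ (suc y) m)

  constant : ∀ p → Linked _≤_ (reverse (replicate p 0))
  constant p = Linked.AllPairs⇒Linked (AllPairs-reverse (≥-zeros p))
    where
    ≥-zeros : ∀ p → AllPairs _≥_ (replicate p 0)
    ≥-zeros zero    = []
    ≥-zeros (suc p) = All.replicate⁺ p z≤n ∷ ≥-zeros p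

  column : ∀ y m → Linked (λ upper lower → Prefix (λ y x → x < y) lower upper) (map [_] (run y m))
  column y zero          = []
  column y (suc zero)    = [-]
  column y (suc (suc m)) = (ℕ.n<1+n y ∷ []) ∷ column (suc y) (suc m)

  columns : Linked (λ upper lower → Prefix (λ y x → x < y) lower upper)
                   (reverse (replicate (suc p) 0) ∷ map [_] (run 1 m))
  -- The column below sees only the first entry of the top row, so the reversed row is replaced by
  -- an arbitrary nonempty list of zeros.
  columns with reverse (replicate (suc p) 0) in eq
    | ↭.All-resp-↭ (↭-sym (↭.↭-reverse (replicate (suc p) 0)))
                   (All.replicate⁺ {P = _≡ 0} (suc p) refl)
  ... | []    | _ with () ← trans (sym (cong length eq)) (List.length-reverse (replicate (suc p) 0))
  ... | x ∷ r | refl ∷ _ = go m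
    where
    go : ∀ m → Linked (λ upper lower → Prefix (λ y x → x < y) lower upper) ((0 ∷ r) ∷ map [_] (run 1 m))
    go zero    = [-]
    go (suc m) = (ℕ.z<s ∷ []) ∷ column 1 (suc m)

sum-ones : ∀ m → sum (replicate m 1) ≡ m
sum-ones zero    = refl
sum-ones (suc m) = cong suc (sum-ones m)

module HookCoefficient {c ℓ} (S : CommutativeRing c ℓ) where
  open CommutativeRing S using (0#; 1#; reflexive; +-cong; +-congˡ; +-identityˡ; +-identityʳ)
    renaming (_≈_ to _∼_; trans to ∼-trans)
  open Sums S
  open Detection S
  open SchurWords S

  ⨁-single : ∀ {xs : List A} {x} f → Unique xs → x ∈ xs →
             (∀ {y} → y ∈ xs → y ≢ x → f y ∼ 0#) → ⨁ xs f ∼ f x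
  ⨁-single f (x∉xs ∷ xs!) (here refl) f∼0 = ∼-trans
    (+-congˡ (⨁-zero _ λ y∈ → f∼0 (there y∈) λ { refl → All.lookup x∉xs y∈ refl })) (+-identityʳ _)
  ⨁-single f (y∉xs ∷ xs!) (there x∈)  f∼0 = ∼-trans
    (+-cong (f∼0 (here refl) λ { refl → All.lookup y∉xs x∈ refl })
            (⨁-single f xs! x∈ (f∼0 ∘ there))) (+-identityˡ _)

  firstMin-[] : ∀ p m g → firstMin [] p m g ∼ ⨁ (hookWords p m) (λ u → g (0 ∷ u))
  firstMin-[] p m g = ∼-trans (⨁-[ [] ] λ v → ⨁ (hookWords p m) λ u → ⨁ (ins v (0 ∷ u)) g)
    (⨁-cong (hookWords p m) λ {u} _ → ⨁-[ 0 ∷ u ] g)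

  -- Corresponds to `s_(p+1,1^m)` having pairing 1 with itself: exactly one hook word, the one with
  -- all zeros in front, is a reading word.
  hook-detected : ∀ p m →
    ⨁ (hookWords p m) (λ u → isReadingWord (suc p ∷ replicate m 1) (0 ∷ u)) ∼ 1#
  hook-detected p m = ∼-trans
    (⨁-single (λ u → isReadingWord (suc p ∷ replicate m 1) (0 ∷ u)) (hookWords-unique p m)
      (replicate++run∈hookWords p m)
      λ {u} u∈ u≢ → reflexive (isReadingWord-no (suc p ∷ replicate m 1) (0 ∷ u) λ s →
        u≢ (proj₂ (hookWord-shape {p} {m} u∈ (All.replicate⁺ m ℕ.z<s) (cong (p ℕ.+_) (sum-ones m)) s))))
    (reflexive (isReadingWord-yes (suc p ∷ replicate m 1) (0 ∷ replicate p 0 ++ run 1 m) (hookWord-semistandard p m)))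

  -- The orthogonality that goes with `hook-detected`: a hook word that is a reading word forces the
  -- hook shape.
  nonhook-undetected : ∀ p m λs → All (0 <_) λs → sum λs ≡ suc p ℕ.+ m →
    λs ≢ suc p ∷ replicate m 1 →
    ⨁ (hookWords p m) (λ u → isReadingWord λs (0 ∷ u)) ∼ 0#
  nonhook-undetected p m (suc l ∷ μ) (_ ∷ μ>0) sum≡ λs≢ = ⨁-zero (hookWords p m) λ {u} u∈ →
    reflexive (isReadingWord-no (suc l ∷ μ) (0 ∷ u) λ s →
      λs≢ (proj₁ (hookWord-shape {p} {m} u∈ μ>0 (ℕ.suc-injective sum≡) s)))

-- Partitions

compositions-sound : ∀ n {α} → α ∈ compositions n → All (0 <_) α × sum α ≡ n
compositions-sound zero    (here refl) = [] , refl
compositions-sound (suc n) α∈ with find (∈-concatMap⁻ _ {xs = compositions n} α∈)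
... | β , β∈ , here refl =
  let β>0 , eq = compositions-sound n β∈ in ℕ.z<s ∷ β>0 , cong suc eq
... | k ∷ β , β∈ , there (here refl) with _ ∷ β>0 , eq ← compositions-sound n β∈ =
  ℕ.z<s ∷ β>0 , cong suc eq

compositions-complete : ∀ {α} → All (0 <_) α → α ∈ compositions (sum α)
compositions-complete []                        = here refl
compositions-complete {suc zero ∷ α}    (_ ∷ α>0) =
  ∈-concatMap⁺ _ (lose (compositions-complete α>0) (here refl))
compositions-complete {suc (suc k) ∷ α} (_ ∷ α>0) =
  ∈-concatMap⁺ _ (lose (compositions-complete {suc k ∷ α} (ℕ.z<s ∷ α>0)) (there (here refl)))

-- A composition determines its parent: drop a leading 1, or decrease a larger head. Without
-- repetitions the hook contributes its coefficient only once to the expansion.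
compositions-unique : ∀ n → Unique (compositions n)
compositions-unique zero    = [] ∷ []
compositions-unique (suc n) = concatMap-unique _ parent (compositions-unique n)
  (λ {α} → children-unique α) (λ {α} → parent-child α)
  where
  parent : List ℕ → List ℕ
  parent (suc (suc k) ∷ α) = suc k ∷ α
  parent (_ ∷ α)           = α
  parent []                = []

  children-unique : ∀ α → α ∈ compositions n → Unique _
  children-unique []          _  = [] ∷ []
  children-unique (zero ∷ α)  α∈ with () ∷ _ , _ ← compositions-sound n α∈
  children-unique (suc k ∷ α) _  = ((λ ()) ∷ []) ∷ [] ∷ []

  parent-child : ∀ α {β} → α ∈ compositions n → β ∈ _ → parent β ≡ α
  parent-child α           _  (here refl)         = refl
  -- A head 0 would produce the child `1 ∷ α`, whose parent is read as `α`; positivity of the parts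
  -- excludes it.
  parent-child (zero ∷ α)  α∈ _ with () ∷ _ , _ ← compositions-sound n α∈
  parent-child (suc k ∷ α) _  (there (here refl)) = refl

hook∈partitions : ∀ p m → suc p ∷ replicate m 1 ∈ partitions (suc p ℕ.+ m)
hook∈partitions p m = ∈-filter⁺ (linked? ℕ._≥?_)
  (subst (λ s → suc p ∷ replicate m 1 ∈ compositions (suc p ℕ.+ s)) (sum-ones m)
    (compositions-complete {suc p ∷ replicate m 1} (ℕ.z<s ∷ All.replicate⁺ m ℕ.z<s)))
  (decreasing (suc p) m ℕ.z<s)
  where
  decreasing : ∀ l m → 1 ≤ l → Linked _≥_ (l ∷ replicate m 1)
  decreasing l zero    _   = [-]
  decreasing l (suc m) 1≤l = 1≤l ∷ decreasing 1 m ℕ.≤-refl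

-- Standard tableaux of hook shape

filter-map : ∀ {p} {P : Pred B p} (P? : Decidable P) (f : A → B) xs →
             filter P? (map f xs) ≡ map f (filter (P? ∘ f) xs)
filter-map P? f []       = refl
filter-map P? f (x ∷ xs) with does (P? (f x))
... | true  = cong (f x ∷_) (filter-map P? f xs)
... | false = filter-map P? f xs

map-≡⁻ : ∀ {f g : A → B} {xs} → map f xs ≡ map g xs → ∀ {x} → x ∈ xs → f x ≡ g x
map-≡⁻ {xs = _ ∷ _} e (here refl) = List.∷-injectiveˡ e
map-≡⁻ {xs = _ ∷ _} e (there x∈)  = map-≡⁻ (List.∷-injectiveʳ e) x∈

-- Identifies the row and the column of a standard hook tableau with filters of `allFin`, for which
-- only membership has to be compared.
sorted-≡ : ∀ {xs ys : List (Fin n)} → AllPairs Fin._<_ xs → AllPairs Fin._<_ ys →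
           (∀ {z} → z ∈ xs → z ∈ ys) → (∀ {z} → z ∈ ys → z ∈ xs) → xs ≡ ys
sorted-≡ {xs = []}     {[]}     _ _ _ _ = refl
sorted-≡ {xs = []}     {y ∷ ys} _ _ _ from with () ← from (here refl)
sorted-≡ {xs = x ∷ xs} {[]}     _ _ to _ with () ← to (here refl)
sorted-≡ {xs = x ∷ xs} {y ∷ ys} (x<xs ∷ xs<) (y<ys ∷ ys<) to from with x≡y
  where
  x≡y : x ≡ y
  x≡y with to (here refl) | from (here refl)
  ... | here e     | _          = e
  ... | there x∈ys | here e     = sym e
  ... | there x∈ys | there y∈xs = contradiction (All.lookup y<ys x∈ys) (ℕ.<-asym (All.lookup x<xs y∈xs))
... | refl = cong (x ∷_) (sorted-≡ xs< ys<
    (λ z∈ → drop-head (All.lookup x<xs z∈) (to (there z∈)))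
    (λ z∈ → drop-head (All.lookup y<ys z∈) (from (there z∈))))
  where
  drop-head : ∀ {z zs} → x Fin.< z → z ∈ x ∷ zs → z ∈ zs
  drop-head x<x (here refl) = contradiction x<x (ℕ.n≮n _)
  drop-head _   (there z∈)  = z∈

allFin-sorted : ∀ n → AllPairs Fin._<_ (allFin n)
allFin-sorted n = AllPairs.tabulate⁺-< id

sorted⇒unique : ∀ {xs : List (Fin n)} → AllPairs Fin._<_ xs → Unique xs
sorted⇒unique = AllPairs.map λ { x<x refl → ℕ.n≮n _ x<x }

multiplicity-1 : ∀ {xs : List (Fin n)} → Unique xs → ∀ {u} → u ∈ xs → length (filter (u Fin.≟_) xs) ≡ 1
multiplicity-1 {xs = x ∷ xs} (x∉xs ∷ _)   (here refl) = trans
  (cong length (List.filter-accept (x Fin.≟_) {xs = xs} refl))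
  (cong (suc ∘ length) (List.filter-none (x Fin.≟_) x∉xs))
multiplicity-1 {xs = x ∷ xs} (x∉xs ∷ xs!) {u} (there u∈)  = trans
  (cong length (List.filter-reject (u Fin.≟_) {xs = xs} (λ { refl → All.lookup x∉xs u∈ refl })))
  (multiplicity-1 xs! u∈)

-- Positions past the end carry the letter 0.
letterAt : List ℕ → ℕ → ℕ
letterAt []      _       = 0
letterAt (x ∷ w) zero    = x
letterAt (x ∷ w) (suc i) = letterAt w i

letterAt-tabulate : ∀ {n} (f : Fin n → ℕ) u → letterAt (List.tabulate f) (toℕ u) ≡ f u
letterAt-tabulate f zero    = refl
letterAt-tabulate f (suc u) = letterAt-tabulate (f ∘ suc) u

letterAt-map : ∀ (f : Fin n → ℕ) u → letterAt (map f (allFin n)) (toℕ u) ≡ f u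
letterAt-map f u = trans (cong (λ w → letterAt w (toℕ u)) (List.map-tabulate id f)) (letterAt-tabulate f u)

map-letterAt : ∀ w {n} → length w ≡ n → map (letterAt w ∘ toℕ) (allFin n) ≡ w
map-letterAt w {n} e = trans (List.map-tabulate id (letterAt w ∘ toℕ)) (go w e)
  where
  go : ∀ w {n} → length w ≡ n → List.tabulate {n = n} (letterAt w ∘ toℕ) ≡ w
  go []      refl = refl
  go (x ∷ w) refl = cong (x ∷_) (go w refl)

atZero? : ∀ (ρ : Fin n → ℕ) → Decidable (λ u → ¬ 0 < ρ u)
atZero? ρ u = ¬? (0 ℕ.<? ρ u)

atPositive? : ∀ (ρ : Fin n → ℕ) → Decidable (λ u → 0 < ρ u)
atPositive? ρ u = 0 ℕ.<? ρ u

-- Inverse to `rowWord` on hook words. The positive letters of such a word increase, so their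
-- positions in increasing order are the entries of rows 2, 3, ... in this order.
hookTableau : (Fin n → ℕ) → Tableau n
hookTableau ρ = filter (atZero? ρ) (allFin _)
              ∷ map [_] (filter (atPositive? ρ) (allFin _))

hookTableau-cong : ∀ {ρ ρ′ : Fin n → ℕ} → (∀ u → ρ u ≡ ρ′ u) → hookTableau ρ ≡ hookTableau ρ′
hookTableau-cong {n} {ρ} {ρ′} e = cong₂ (λ r c → r ∷ map [_] c)
  (List.filter-≐ (atZero? ρ) (atZero? ρ′) ((λ {u} → subst (λ x → ¬ 0 < x) (e u))
    , λ {u} → subst (λ x → ¬ 0 < x) (sym (e u))) (allFin n))
  (List.filter-≐ (atPositive? ρ) (atPositive? ρ′) ((λ {u} → subst (0 <_) (e u))
    , λ {u} → subst (0 <_) (sym (e u))) (allFin n))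

map-suc-run : ∀ y m → map suc (run y m) ≡ run (suc y) m
map-suc-run y zero    = refl
map-suc-run y (suc m) = cong (suc y ∷_) (map-suc-run (suc y) m)

module _ {n : ℕ} where
  open DecMembership (Fin._≟_ {n}) using (_∈?_)

  rowOf-∈ : ∀ {r T} {u : Fin n} → u ∈ r → rowOf (r ∷ T) u ≡ 1
  rowOf-∈ {r} {T} {u} u∈ rewrite dec-true (u ∈? r) u∈ = refl

  rowOf-∉ : ∀ {r T} {u : Fin n} → u ∉ r → rowOf (r ∷ T) u ≡ suc (rowOf T u)
  rowOf-∉ {r} {T} {u} u∉ rewrite dec-false (u ∈? r) u∉ = refl

  rowOf>0 : ∀ T (u : Fin n) → 0 < rowOf T u
  rowOf>0 []      u = ℕ.z<s
  rowOf>0 (r ∷ T) u with does (u ∈? r)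
  ... | true  = ℕ.z<s
  ... | false = ℕ.z<s

  rowOf-column : ∀ {c : List (Fin n)} → Unique c → map (rowOf (map [_] c)) c ≡ run 1 (length c)
  rowOf-column []                  = refl
  rowOf-column {x ∷ c} (x∉c ∷ c!) = cong₂ _∷_ (rowOf-∈ {r = [ x ]} {T = map [_] c} (here refl)) (begin
    map (rowOf ([ x ] ∷ map [_] c)) c  ≡⟨ List.map-cong-local (All.map (λ x≢u →
                                            rowOf-∉ {r = [ x ]} {T = map [_] c} λ { (here refl) → x≢u refl }) x∉c) ⟩
    map (suc ∘ rowOf (map [_] c)) c    ≡⟨ List.map-∘ c ⟩
    map suc (map (rowOf (map [_] c)) c) ≡⟨ cong (map suc) (rowOf-column c!) ⟩
    map suc (run 1 (length c))         ≡⟨ map-suc-run 1 (length c) ⟩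
    run 2 (length c)                   ∎)
    where open ≡-Reasoning

  -- Rows are counted from 1 but letters from 0, hence the subtraction.
  rowWord : Tableau n → List ℕ
  rowWord T = map (λ u → rowOf T u ℕ.∸ 1) (allFin n)

  letterAt-rowWord : ∀ T u → suc (letterAt (rowWord T) (toℕ u)) ≡ rowOf T u
  letterAt-rowWord T u = trans (cong suc (letterAt-map _ u)) (ℕ.m+[n∸m]≡n (rowOf>0 T u))

columns-of-singletons : ∀ {m} {T : List (List A)} → map length T ≡ replicate m 1 →
                        Σ[ c ∈ List A ] T ≡ map [_] c × length c ≡ m
columns-of-singletons {m = zero}  {[]}          e = [] , refl , refl
columns-of-singletons {m = suc m} {(x ∷ []) ∷ T} e =
  let c , e₁ , e₂ = columns-of-singletons (List.∷-injectiveʳ e) in x ∷ c , cong ([ x ] ∷_) e₁ , cong suc e₂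
columns-of-singletons {m = suc m} {[] ∷ T} e with () ← List.∷-injectiveˡ e
columns-of-singletons {m = suc m} {(x ∷ y ∷ r) ∷ T} e with () ← List.∷-injectiveˡ e

module Hook (p m : ℕ) where
  private
    d : ℕ
    d = suc p ℕ.+ m

    shape : List ℕ
    shape = suc p ∷ replicate m 1

  -- The consequences of standardness that the bijection uses. `disjoint` and `covers` replace the
  -- condition that every entry has multiplicity one.
  record HookSYT (T : Tableau d) : Set where
    field
      row      : List (Fin d)
      column   : List (Fin d)
      T≡       : T ≡ row ∷ map [_] column
      length-r : length row ≡ suc p
      length-c : length column ≡ m
      row<     : AllPairs Fin._<_ row
      column<  : AllPairs Fin._<_ column
      zero∉c   : zero ∉ column
      disjoint : ∀ {u} → u ∈ row → u ∉ column
      covers   : ∀ u → u ∉ row → u ∈ column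

  hookSYT : ∀ {T} → T ∈ SYT shape d → HookSYT T
  hookSYT {T} T∈ with T∈′ , (rows , columns , content≡) ← ∈-filter⁻ isSYT? {xs = fillings shape d} T∈
    with r ∷ T′ ← T | e ← ∈-fillings⁻ shape T∈′
    with c , refl , len-c ← columns-of-singletons {T = T′} (List.∷-injectiveʳ e) = record
    { row      = r
    ; column   = c
    ; T≡       = refl
    ; length-r = List.∷-injectiveˡ e
    ; length-c = len-c
    ; row<     = Linked.Linked⇒AllPairs Fin.<-trans (All.head rows)
    ; column<  = Linked.Linked⇒AllPairs Fin.<-trans (tail< {r} columns)
    -- Every entry of the column has a smaller entry above it.
    ; zero∉c   = λ 0∈c → ℕ.n≮0 (proj₂ (head< (List.∷-injectiveˡ e) columns 0∈c))
    ; disjoint = λ {u} u∈r u∈c → ℕ.n≮n 1 (subst (1 <_) (once u)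
        (subst (1 <_) (sym (trans (cong length (List.filter-++ (u Fin.≟_) r (concat (map [_] c))))
                                  (List.length-++ (filter (u Fin.≟_) r))))
          (ℕ.+-mono-≤ (positive u∈r) (positive (subst (u ∈_) (sym (List.concat-map-[_] c)) u∈c)))))
    ; covers   = covered
    }
    where
    once : ∀ u → length (filter (u Fin.≟_) (r ++ concat (map [_] c))) ≡ 1
    once u = trans (sym (Vec.lookup∘tabulate (λ v → length (filter (v Fin.≟_) (r ++ concat (map [_] c)))) u))
      (trans (cong (λ v → lookup v u) content≡) (Vec.lookup-replicate u 1))

    positive : ∀ {u : Fin d} {xs} → u ∈ xs → 0 < length (filter (u Fin.≟_) xs)
    positive {u} {xs} u∈ with filter (u Fin.≟_) xs | ∈-filter⁺ (u Fin.≟_) u∈ refl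
    ... | _ ∷ _ | _ = ℕ.z<s

    covered : ∀ u → u ∉ r → u ∈ c
    covered u u∉r with filter (u Fin.≟_) (r ++ concat (map [_] c)) in eq | once u
    ... | v ∷ _ | _
      with v∈ , refl ← ∈-filter⁻ (u Fin.≟_) {v} {xs = r ++ concat (map [_] c)}
                         (subst (v ∈_) (sym eq) (here refl))
      with ∈-++⁻ r v∈
    ... | inj₁ u∈r = contradiction u∈r u∉r
    ... | inj₂ u∈c = subst (u ∈_) (List.concat-map-[_] c) u∈c

    Columns : Tableau d → Set
    Columns = Linked λ upper lower → Prefix (λ y x → toℕ x < toℕ y) lower upper

    column-linked : ∀ {c} → Columns (map [_] c) → Linked Fin._<_ c
    column-linked {[]}        []            = []
    column-linked {_ ∷ []}    [-]           = [-]
    column-linked {_ ∷ _ ∷ _} ((x<y ∷ _) ∷ l) = x<y ∷ column-linked l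

    tail< : ∀ {r c} → Columns (r ∷ map [_] c) → Linked Fin._<_ c
    tail< {c = []}    _       = []
    tail< {c = _ ∷ _} (_ ∷ l) = column-linked l

    head< : ∀ {r c : List (Fin d)} {u} → length r ≡ suc p → Columns (r ∷ map [_] c) → u ∈ c →
            ∃ λ (x : Fin d) → toℕ x < toℕ u
    head< {x ∷ r} {y ∷ c} _ ((x<y ∷ _) ∷ l) (here refl) = x , x<y
    head< {x ∷ r} {y ∷ c} _ ((x<y ∷ _) ∷ l) (there u∈)
      with y<c ∷ _ ← Linked.Linked⇒AllPairs Fin.<-trans (column-linked {y ∷ c} l) = y , All.lookup y<c u∈

  module _ {T : Tableau d} (H : HookSYT T) where
    open HookSYT H
    private
      ρ : Fin d → ℕ
      ρ u = rowOf T u ℕ.∸ 1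

      ρ-row : ∀ {u} → u ∈ row → ρ u ≡ 0
      ρ-row u∈ rewrite T≡ = cong (ℕ._∸ 1) (rowOf-∈ {T = map [_] column} u∈)

      ρ-column : ∀ {u} → u ∈ column → ρ u ≡ rowOf (map [_] column) u
      ρ-column u∈ rewrite T≡ = cong (ℕ._∸ 1) (rowOf-∉ {T = map [_] column} λ u∈r → disjoint u∈r u∈)

      row≡ : filter (atZero? ρ) (allFin d) ≡ row
      row≡ = sorted-≡ (AllPairs.filter⁺ (atZero? ρ) (allFin-sorted d)) row<
        (λ {u} u∈ → in-row u (proj₂ (∈-filter⁻ (atZero? ρ) {xs = allFin d} u∈)))
        (λ {u} u∈ → ∈-filter⁺ (atZero? ρ) (∈-allFin u) (λ 0<ρ → ℕ.n≮0 (subst (0 <_) (ρ-row u∈) 0<ρ)))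
        where
        in-row : ∀ u → ¬ 0 < ρ u → u ∈ row
        in-row u ρ≯0 with DecMembership._∈?_ Fin._≟_ u row
        ... | yes u∈ = u∈
        ... | no  u∉ = contradiction (subst (0 <_) (sym (ρ-column (covers u u∉))) (rowOf>0 (map [_] column) u)) ρ≯0

      column≡ : filter (atPositive? ρ) (allFin d) ≡ column
      column≡ = sorted-≡ (AllPairs.filter⁺ (atPositive? ρ) (allFin-sorted d)) column<
        (λ {u} u∈ → covers u λ u∈r → ℕ.n≮0 (subst (0 <_) (ρ-row u∈r)
          (proj₂ (∈-filter⁻ (atPositive? ρ) {xs = allFin d} u∈))))
        (λ {u} u∈ → ∈-filter⁺ (atPositive? ρ) (∈-allFin u) (subst (0 <_) (sym (ρ-column u∈)) (rowOf>0 (map [_] column) u)))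

    hookTableau-rowOf : hookTableau ρ ≡ T
    hookTableau-rowOf = trans (cong₂ (λ r c → r ∷ map [_] c) row≡ column≡) (sym T≡)

    -- The smallest entry lies in the first row, so the word starts with 0. The rest is the shuffle
    -- of its zeros with its positive letters, and reading the column downwards meets the rows 2, 3,
    -- ... in order.
    rowWord∈ : rowWord T ∈ map (0 ∷_) (hookWords p m)
    rowWord∈ = subst (_∈ map (0 ∷_) (hookWords p m)) (cong (_∷ map ρ (tail≡)) (sym ρ0))
      (∈-map⁺ (0 ∷_) (subst₂ (λ us vs → map ρ tail≡ ∈ ins us vs) zeros≡ positive≡
        (∈-ins-filter (0 ℕ.<?_) (map ρ tail≡))))
      where
      open ≡-Reasoning
      tail≡ : List (Fin d)
      tail≡ = List.tabulate suc

      ρ0 : ρ zero ≡ 0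
      ρ0 with DecMembership._∈?_ Fin._≟_ zero row
      ... | yes 0∈ = ρ-row 0∈
      ... | no  0∉ = contradiction (covers zero 0∉) zero∉c

      zeros≡ : filter (¬? ∘ (0 ℕ.<?_)) (map ρ tail≡) ≡ replicate p 0
      -- The first row contains the smallest entry, so its letter 0 is put in front for the count
      -- and cancelled afterwards.
      zeros≡ = List.∷-injectiveʳ (begin
        0 ∷ filter (¬? ∘ (0 ℕ.<?_)) (map ρ tail≡)
          ≡⟨ List.filter-accept (¬? ∘ (0 ℕ.<?_)) {xs = map ρ tail≡} (ℕ.n≮n 0) ⟨
        filter (¬? ∘ (0 ℕ.<?_)) (0 ∷ map ρ tail≡)
          ≡⟨ cong (λ x → filter (¬? ∘ (0 ℕ.<?_)) (x ∷ map ρ tail≡)) ρ0 ⟨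
        filter (¬? ∘ (0 ℕ.<?_)) (map ρ (allFin d))
          ≡⟨ filter-map (¬? ∘ (0 ℕ.<?_)) ρ (allFin d) ⟩
        map ρ (filter (atZero? ρ) (allFin d))
          ≡⟨ cong (map ρ) row≡ ⟩
        map ρ row
          ≡⟨ all-≡-replicate (All.map⁺ (All.tabulate ρ-row)) ⟩
        replicate (length (map ρ row)) 0
          ≡⟨ cong (λ k → replicate k 0) (trans (List.length-map ρ row) length-r) ⟩
        replicate (suc p) 0 ∎)

      positive≡ : filter (0 ℕ.<?_) (map ρ tail≡) ≡ run 1 m
      positive≡ = begin
        filter (0 ℕ.<?_) (map ρ tail≡)
          ≡⟨ List.filter-reject (0 ℕ.<?_) {xs = map ρ tail≡} (ℕ.n≮n 0) ⟨
        filter (0 ℕ.<?_) (0 ∷ map ρ tail≡)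
          ≡⟨ cong (λ x → filter (0 ℕ.<?_) (x ∷ map ρ tail≡)) ρ0 ⟨
        filter (0 ℕ.<?_) (map ρ (allFin d))
          ≡⟨ filter-map (0 ℕ.<?_) ρ (allFin d) ⟩
        map ρ (filter (atPositive? ρ) (allFin d))
          ≡⟨ cong (map ρ) column≡ ⟩
        map ρ column
          ≡⟨ List.map-cong-local (All.tabulate ρ-column) ⟩
        map (rowOf (map [_] column)) column
          ≡⟨ rowOf-column (sorted⇒unique column<) ⟩
        run 1 (length column)
          ≡⟨ cong (run 1) length-c ⟩
        run 1 m ∎

  module _ {u : List ℕ} (u∈ : u ∈ hookWords p m) where
    private
      w : List ℕ
      w = 0 ∷ u

      ρ : Fin d → ℕ
      ρ = letterAt w ∘ toℕ

      w≡ : map ρ (allFin d) ≡ w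
      w≡ = map-letterAt w (cong suc (length-hookWords {p} {m} u∈))

      r c : List (Fin d)
      r = filter (atZero? ρ) (allFin d)
      c = filter (atPositive? ρ) (allFin d)

      map-r : map ρ r ≡ replicate (suc p) 0
      map-r = begin
        map ρ r                                    ≡⟨ filter-map (¬? ∘ (0 ℕ.<?_)) ρ (allFin d) ⟨
        filter (¬? ∘ (0 ℕ.<?_)) (map ρ (allFin d)) ≡⟨ cong (filter (¬? ∘ (0 ℕ.<?_))) w≡ ⟩
        filter (¬? ∘ (0 ℕ.<?_)) w                  ≡⟨ List.filter-accept (¬? ∘ (0 ℕ.<?_)) {xs = u} (ℕ.n≮n 0) ⟩
        0 ∷ filter (¬? ∘ (0 ℕ.<?_)) u              ≡⟨ cong (0 ∷_) (proj₁ (hookWords-filter {p} {m} u∈)) ⟩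
        replicate (suc p) 0                        ∎
        where open ≡-Reasoning

      map-c : map ρ c ≡ run 1 m
      map-c = begin
        map ρ c                             ≡⟨ filter-map (0 ℕ.<?_) ρ (allFin d) ⟨
        filter (0 ℕ.<?_) (map ρ (allFin d)) ≡⟨ cong (filter (0 ℕ.<?_)) w≡ ⟩
        filter (0 ℕ.<?_) w                  ≡⟨ List.filter-reject (0 ℕ.<?_) {xs = u} (ℕ.n≮n 0) ⟩
        filter (0 ℕ.<?_) u                  ≡⟨ proj₂ (hookWords-filter {p} {m} u∈) ⟩
        run 1 m                             ∎
        where open ≡-Reasoning

      length-r : length r ≡ suc p
      length-r = trans (sym (List.length-map ρ r)) (trans (cong length map-r) (List.length-replicate (suc p)))

      length-c : length c ≡ m
      length-c = trans (sym (List.length-map ρ c)) (trans (cong length map-c) (length-run 1 m))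

      c-sorted : AllPairs Fin._<_ c
      c-sorted = AllPairs.filter⁺ (atPositive? ρ) (allFin-sorted d)

      c>0 : All (λ v → 0 < toℕ v) c
      c>0 = All.map (λ { {zero} 0<0 → contradiction 0<0 (ℕ.n≮n 0) ; {suc v} _ → ℕ.z<s })
                    (All.all-filter (atPositive? ρ) (allFin d))

      column-linked : ∀ {c : List (Fin d)} → Linked Fin._<_ c → Linked (λ upper lower →
        Prefix (λ y x → toℕ x < toℕ y) lower upper) (map [_] c)
      column-linked []        = []
      column-linked [-]       = [-]
      column-linked (x<y ∷ l) = (x<y ∷ []) ∷ column-linked l

      strict : ColumnStrict (hookTableau ρ)
      -- The word begins with 0, so the smallest entry heads the first row and lies above the
      -- positive top of the column.
      strict rewrite List.filter-accept (atZero? ρ) {x = zero} {xs = List.tabulate suc} (ℕ.n≮n 0)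
        with c | c>0 | c-sorted
      ... | []     | _        | _  = [-]
      ... | v ∷ vs | 0<v ∷ _  | c< = (0<v ∷ []) ∷ column-linked (Linked.AllPairs⇒Linked c<)

      standard : content (concat (hookTableau ρ)) ≡ Vec.replicate d 1
      standard = trans (Vec.tabulate-cong λ v → begin
        length (filter (v Fin.≟_) (r ++ concat (map [_] c)))
          ≡⟨ cong (λ z → length (filter (v Fin.≟_) (r ++ z))) (List.concat-map-[_] c) ⟩
        length (filter (v Fin.≟_) (r ++ c))
          -- All entries form a shuffle of row and column, hence a permutation of their
          -- concatenation.
          ≡⟨ ↭.↭-length (↭.filter-↭ (v Fin.≟_) (ins-↭ r c (∈-ins-filter (atPositive? ρ) (allFin d)))) ⟨
        length (filter (v Fin.≟_) (allFin d))                 ≡⟨ multiplicity-1 (Unique.allFin⁺ d) (∈-allFin v) ⟩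
        1                                                     ≡⟨ Vec.lookup-replicate v 1 ⟨
        lookup (Vec.replicate d 1) v                          ∎) (Vec.tabulate∘lookup (Vec.replicate d 1))
        where open ≡-Reasoning

      lengths-1 : ∀ (c : List (Fin d)) → map length (map [_] c) ≡ replicate (length c) 1
      lengths-1 []      = refl
      lengths-1 (_ ∷ c) = cong (1 ∷_) (lengths-1 c)

    hookTableau∈SYT : hookTableau ρ ∈ SYT shape d
    hookTableau∈SYT = ∈-filter⁺ isSYT?
      (subst (λ s → hookTableau ρ ∈ fillings s d)
        (cong₂ _∷_ length-r (trans (lengths-1 c) (cong (λ k → replicate k 1) length-c)))
        (∈-fillings⁺ (hookTableau ρ)))
      ( (Linked.AllPairs⇒Linked (AllPairs.filter⁺ (atZero? ρ) (allFin-sorted d)) ∷ All.map⁺ (All.universal (λ _ → [-]) c))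
      , strict , standard)

    rowWord-hookTableau : rowWord (hookTableau ρ) ≡ w
    rowWord-hookTableau = trans (List.map-cong agree (allFin d)) w≡
      where
      agree : ∀ v → rowOf (hookTableau ρ) v ℕ.∸ 1 ≡ ρ v
      agree v with 0 ℕ.<? ρ v
      ... | no ρ≯0 = trans (cong (ℕ._∸ 1) (rowOf-∈ {T = map [_] c} (∈-filter⁺ (atZero? ρ) (∈-allFin v) ρ≯0)))
        (sym (ℕ.n≤0⇒n≡0 (ℕ.≮⇒≥ ρ≯0)))
      ... | yes ρ>0 = trans
        (cong (ℕ._∸ 1) (rowOf-∉ {r = r} {T = map [_] c} λ v∈ → proj₂ (∈-filter⁻ (atZero? ρ) {xs = allFin d} v∈) ρ>0))
        -- Along the column both the row numbers and the letters run through 1, ..., m; comparing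
        -- the two lists at `v` gives the equality.
        (map-≡⁻ {f = rowOf (map [_] c)} {g = ρ}
          (trans (rowOf-column (sorted⇒unique c-sorted)) (trans (cong (run 1) length-c) (sym map-c)))
          (∈-filter⁺ (atPositive? ρ) (∈-allFin v) ρ>0))

  module _ {c ℓ} (S : CommutativeRing c ℓ) where
    open CommutativeRing S using () renaming (_≈_ to _∼_; sym to ∼-sym; trans to ∼-trans)
    open Sums S

    ⨁-SYT : ∀ g → ⨁ (SYT shape d) (g ∘ rowWord) ∼ ⨁ (hookWords p m) (λ u → g (0 ∷ u))
    ⨁-SYT g = ∼-trans (∼-sym (⨁-map rowWord (SYT shape d) g)) (∼-trans
      (⨁-set g
        (map-unique rowWord (λ w → hookTableau (letterAt w ∘ toℕ))
          (λ {T} T∈ → trans (hookTableau-cong (letterAt-map λ u → rowOf T u ℕ.∸ 1)) (hookTableau-rowOf (hookSYT T∈)))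
          (Unique.filter⁺ isSYT? (fillings-unique shape d)))
        (Unique.map⁺ List.∷-injectiveʳ (hookWords-unique p m))
        (λ w∈ → let T , T∈ , e = ∈-map⁻ rowWord w∈ in
          subst (_∈ map (0 ∷_) (hookWords p m)) (sym e) (rowWord∈ (hookSYT T∈)))
        (λ w∈ → let u , u∈ , e = ∈-map⁻ (0 ∷_) w∈ in
          subst (_∈ map rowWord (SYT shape d)) (trans (rowWord-hookTableau u∈) (sym e))
            (∈-map⁺ rowWord (hookTableau∈SYT u∈))))
      (⨁-map (0 ∷_) (hookWords p m) g))

-- Web LLT functions

letterAt-agree : ∀ {zs} → AllPairs Agree zs → ∀ {i j} → i < j →
  Agree (letterAt (map proj₁ zs) i , letterAt (map proj₂ zs) i)
        (letterAt (map proj₁ zs) j , letterAt (map proj₂ zs) j)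
letterAt-agree []         _                   = id , id
letterAt-agree (z≎ ∷ zs≎) {zero}  {suc j} _   = go z≎ j
  where
  go : ∀ {z zs} → All (Agree z) zs → ∀ j →
       Agree z (letterAt (map proj₁ zs) j , letterAt (map proj₂ zs) j)
  -- Past the end both later letters are 0, and no letter is smaller than 0.
  go []       j       = (λ ()) , (λ ())
  go (z≎ ∷ _) zero    = z≎
  go (_ ∷ z≎) (suc j) = go z≎ j
letterAt-agree (_ ∷ zs≎)  {suc i} {suc j} i<j = letterAt-agree zs≎ (ℕ.s<s⁻¹ i<j)

Attacks : ∀ {d} → (Fin d → ℕ) → Fin d → Fin d → Set
Attacks σ u v = σ u < σ v ⊎ (σ v ≡ σ u × v Fin.< u)

-- For `u < v` an attack means `σ u < σ v`; for `v < u` it means that `σ v < σ u` fails; for `u = v`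
-- there is none. Thus only the comparison of an earlier with a later letter matters: the tie rule
-- of `ε` is that of the standardisation.
attacks-agree : ∀ {d} {σ τ : Fin d → ℕ} → (∀ {u v} → u Fin.< v → Agree (σ u , τ u) (σ v , τ v)) →
                ∀ {u v} → Attacks σ u v → Attacks τ u v
attacks-agree {σ = σ} {τ} agree {u} {v} a with Fin.<-cmp u v
... | tri< u<v _ v≮u with a
...   | inj₁ σu<σv      = inj₁ (proj₁ (agree u<v) σu<σv)
...   | inj₂ (_ , v<u)  = contradiction v<u v≮u
attacks-agree agree (inj₁ σu<σu)      | tri≈ _ refl _   = contradiction σu<σu (ℕ.n≮n _)
attacks-agree agree (inj₂ (_ , u<u))  | tri≈ _ refl _   = contradiction u<u (ℕ.n≮n _)
attacks-agree {σ = σ} {τ} agree {u} {v} a | tri> _ _ v<u with ℕ.<-cmp (τ u) (τ v)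
... | tri< τu<τv _ _  = inj₁ τu<τv
... | tri≈ _ τu≡τv _  = inj₂ (sym τu≡τv , v<u)
... | tri> _ _ τv<τu with a
...   | inj₁ σu<σv       = contradiction (proj₂ (agree v<u) τv<τu) (ℕ.<-asym σu<σv)
...   | inj₂ (σv≡σu , _) = contradiction (proj₂ (agree v<u) τv<τu) (ℕ.<-irrefl σv≡σu)

module _ (w : AnnularWeb) (I : RadialCut w) where
  private
    d : ℕ
    d = degree w

  inv-agree : ∀ L {σ τ : Fin d → ℕ} → (∀ {u v} → u Fin.< v → Agree (σ u , τ u) (σ v , τ v)) →
              inv w I L σ ≡ inv w I L τ
  inv-agree L {σ} {τ} agree = go (attackingPairs w I L)
    where
    ε-agree : ∀ p → ε w I σ p ≡ ε w I τ p
    ε-agree (u , v) = cong (if_then 1ℤ else -1ℤ) (does-⇔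
      (mk⇔ (attacks-agree {σ = σ} {τ} agree) (attacks-agree {σ = τ} {σ} (Product.swap ∘ agree)))
      (σ u ℕ.<? σ v ⊎-dec (σ v ℕ.≟ σ u ×-dec v Fin.<? u))
      (τ u ℕ.<? τ v ⊎-dec (τ v ℕ.≟ τ u ×-dec v Fin.<? u)))

    go : ∀ ps → foldr (λ p s → ε w I σ p ℤ.+ s) 0ℤ ps ≡ foldr (λ p s → ε w I τ p ℤ.+ s) 0ℤ ps
    go []       = refl
    go (p ∷ ps) = cong₂ ℤ._+_ (ε-agree p) (go ps)

  inv-cong : ∀ L {σ τ : Fin d → ℕ} → (∀ u → σ u ≡ τ u) → inv w I L σ ≡ inv w I L τ
  inv-cong L e = inv-agree L λ {u} {v} _ → subst₂ _<_ (e u) (e v) , subst₂ _<_ (sym (e u)) (sym (e v))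

-- `C` stands for the inverse of the quantum factorial and `pow` for the powers of `q`. With these
-- and the ring abstract, fractions do not unfold inside the sums.
module WebLLT {a ℓ} (S : CommutativeRing a ℓ) (w : AnnularWeb) (I : RadialCut w)
  (C : CommutativeRing.Carrier S) (pow : ℤ → CommutativeRing.Carrier S) where

  open CommutativeRing S
    using (Carrier; 1#; _*_; setoid; reflexive; *-congˡ; *-identityʳ; zeroʳ)
    renaming (_≈_ to _∼_; sym to ∼-sym; trans to ∼-trans)
  open Sums S
  open Detection S
  open Words S
  open SchurWords S
  open HookCoefficient S

  private
    d : ℕ
    d = degree w

  webLLT : Vec ℕ N → Carrier
  webLLT {N} a = C * ⨁ (SLD w I) λ L →
    ⨁ (filter (λ σ → content (toList σ) ≟ᵐ a) (words (allFin N) d)) λ σ →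
      pow (inv w I L (suc ∘ toℕ ∘ lookup σ))

  schurCoefficient : List ℕ → Vec ℕ N → Carrier
  schurCoefficient {N} λs a =
    ⨁ (filter (λ T → content (concat T) ≟ᵐ a) (SSYT λs N)) λ _ → 1#

  -- The `suc` turns letters, counted from 0, into the positive values of σ, and likewise into row
  -- numbers.
  loopWeight : Labelling w I → List ℕ → Carrier
  loopWeight L z = pow (inv w I L (λ u → suc (letterAt z (toℕ u))))

  lltWeight : List ℕ → Carrier
  lltWeight z = C * ⨁ (SLD w I) λ L → loopWeight L z

  lltWeight-invariant : StdInvariant lltWeight
  lltWeight-invariant zs agree = *-congˡ (⨁-cong (SLD w I) λ {L} _ → reflexive (cong pow
    (inv-agree w I L λ u<v → let f , g = letterAt-agree agree u<v in
      ℕ.s<s ∘ f ∘ ℕ.s<s⁻¹ , ℕ.s<s ∘ g ∘ ℕ.s<s⁻¹)))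

  ⨁-lltWeight : ∀ (zs : List (List ℕ)) →
    ⨁ zs lltWeight ∼ C * ⨁ (SLD w I) (λ L → ⨁ zs (loopWeight L))
  ⨁-lltWeight zs = ∼-trans
    (∼-sym (⨁-*ˡ C zs λ z → ⨁ (SLD w I) λ L → loopWeight L z))
    (*-congˡ (⨁-swap zs (SLD w I) λ z L → loopWeight L z))

  LLT-words : ∀ b → sum b ≡ d → webLLT (exponents b) ∼ ⨁ (arr b) lltWeight
  LLT-words b b⊢d = ∼-sym (∼-trans (⨁-lltWeight (arr b)) (*-congˡ (⨁-cong (SLD w I) λ {L} _ →
    ∼-trans (∼-sym (⨁-words b b⊢d (loopWeight L)))
      (⨁-cong σs λ {σ} _ → reflexive (cong pow (inv-cong w I L λ u → cong suc (letter σ u)))))))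
    where
    σs : List (Vec (Fin (length b)) d)
    σs = filter (λ σ → content (toList σ) ≟ᵐ exponents b) (words (allFin (length b)) d)

    letter : ∀ {N n} (σ : Vec (Fin N) n) u → letterAt (map toℕ (toList σ)) (toℕ u) ≡ toℕ (lookup σ u)
    letter (i ∷ σ) zero    = refl
    letter (i ∷ σ) (suc u) = letter σ u

  module _ (c : List ℕ → Carrier) (expansion : ∀ {N} (a : Vec ℕ N) → webLLT a ∼
      ⨁ (partitions (Vec.sum a)) λ λs → c λs * schurCoefficient λs a) where
    -- The Schur expansion spread over words by means of reading words. It is to be compared with
    -- `lltWeight` after summing over a content, not word by word.
    schurWeight : List ℕ → Carrier
    schurWeight z = ⨁ (partitions d) λ λs → c λs * isReadingWord λs z

    schurWeight-invariant : StdInvariant schurWeight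
    schurWeight-invariant zs agree = ⨁-cong (partitions d) λ {λs} _ →
      *-congˡ (isReadingWord-invariant λs zs agree)

    ⨁-schurWeight : ∀ {A : Set} (zs : List A) (f : A → List ℕ) →
      ⨁ zs (schurWeight ∘ f) ∼ ⨁ (partitions d) λ λs → c λs * ⨁ zs (isReadingWord λs ∘ f)
    ⨁-schurWeight zs f = ∼-trans
      (⨁-swap zs (partitions d) λ z λs → c λs * isReadingWord λs (f z))
      (⨁-cong (partitions d) λ {λs} _ → ∼-sym (⨁-*ˡ (c λs) zs (isReadingWord λs ∘ f)))

    partition-sum : ∀ {λs} → λs ∈ partitions d → All (0 <_) λs × sum λs ≡ d
    partition-sum λs∈ = compositions-sound d (proj₁ (∈-filter⁻ (linked? ℕ._≥?_) {xs = compositions d} λs∈))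

    -- The hypothesis on the expansion, used in exactly `length b` variables and at the monomial
    -- with exponents `b`.
    same-sums : ∀ b → sum b ≡ d → ⨁ (arr b) lltWeight ∼ ⨁ (arr b) schurWeight
    same-sums b b⊢d = begin
      ⨁ (arr b) lltWeight
        ≈⟨ LLT-words b b⊢d ⟨
      webLLT (exponents b)
        ≈⟨ expansion (exponents b) ⟩
      ⨁ (partitions (Vec.sum (exponents b))) (λ λs → c λs * schurCoefficient λs (exponents b))
        ≈⟨ ⨁-≡ (cong partitions (trans (sum-exponents b) b⊢d)) ⟩
      ⨁ (partitions d) (λ λs → c λs * schurCoefficient λs (exponents b))
        ≈⟨ ⨁-cong (partitions d) (λ {λs} λs∈ → *-congˡ
             (⨁-schur λs b (trans b⊢d (sym (proj₂ (partition-sum λs∈)))))) ⟩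
      ⨁ (partitions d) (λ λs → c λs * ⨁ (arr b) (isReadingWord λs))
        ≈⟨ ⨁-schurWeight (arr b) id ⟨
      ⨁ (arr b) schurWeight ∎
      where open import Relation.Binary.Reasoning.Setoid setoid

    hook-coefficient : ∀ p m → suc p ℕ.+ m ≡ d →
      c (suc p ∷ replicate m 1) ∼
      C * ⨁ (SLD w I) (λ L → ⨁ (SYT (suc p ∷ replicate m 1) d) λ T → pow (inv w I L (rowOf T)))
    hook-coefficient p m eq = begin
      c shape
        ≈⟨ *-identityʳ (c shape) ⟨
      c shape * 1#
        ≈⟨ *-congˡ (hook-detected p m) ⟨
      c shape * ⨁ (hookWords p m) (λ u → isReadingWord shape (0 ∷ u))
        ≈⟨ ⨁-single (λ λs → c λs * ⨁ (hookWords p m) (λ u → isReadingWord λs (0 ∷ u)))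
             (Unique.filter⁺ (linked? ℕ._≥?_) (compositions-unique d))
             (subst (λ n → shape ∈ partitions n) eq (hook∈partitions p m))
             (λ {λs} λs∈ λs≢ → let λs>0 , λs⊢d = partition-sum λs∈ in
               ∼-trans (*-congˡ (nonhook-undetected p m λs λs>0 (trans λs⊢d (sym eq)) λs≢))
                       (zeroʳ (c λs))) ⟨
      ⨁ (partitions d) (λ λs → c λs * ⨁ (hookWords p m) (λ u → isReadingWord λs (0 ∷ u)))
        ≈⟨ ⨁-schurWeight (hookWords p m) (0 ∷_) ⟨
      ⨁ (hookWords p m) (λ u → schurWeight (0 ∷ u))
        ≈⟨ firstMin-[] p m schurWeight ⟨
      firstMin [] p m schurWeight
        ≈⟨ firstMin-unique lltWeight-invariant schurWeight-invariant same-sums m [] p total ⟨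
      firstMin [] p m lltWeight
        ≈⟨ firstMin-[] p m lltWeight ⟩
      ⨁ (hookWords p m) (λ u → lltWeight (0 ∷ u))
        ≈⟨ ⨁-map (0 ∷_) (hookWords p m) lltWeight ⟨
      ⨁ (map (0 ∷_) (hookWords p m)) lltWeight
        ≈⟨ ⨁-lltWeight (map (0 ∷_) (hookWords p m)) ⟩
      C * ⨁ (SLD w I) (λ L → ⨁ (map (0 ∷_) (hookWords p m)) (loopWeight L))
        ≈⟨ *-congˡ (⨁-cong (SLD w I) λ {L} _ → tableaux L) ⟩
      C * ⨁ (SLD w I) (λ L → ⨁ (SYT shape d) λ T → pow (inv w I L (rowOf T))) ∎
      where
      open import Relation.Binary.Reasoning.Setoid setoid
      shape = suc p ∷ replicate m 1

      total : suc m ℕ.+ (p ℕ.+ 0) ≡ d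
      total = trans (cong suc (trans (cong (m ℕ.+_) (ℕ.+-identityʳ p)) (ℕ.+-comm m p))) eq

      -- The degree of the web is replaced by a variable, so that the equation can be matched with
      -- `refl`.
      SYT-words : ∀ {n} → suc p ℕ.+ m ≡ n → ∀ g →
        ⨁ (SYT shape n) (g ∘ rowWord) ∼ ⨁ (hookWords p m) (λ u → g (0 ∷ u))
      SYT-words refl g = Hook.⨁-SYT p m S g

      tableaux : ∀ L → ⨁ (map (0 ∷_) (hookWords p m)) (loopWeight L) ∼
                       ⨁ (SYT shape d) (λ T → pow (inv w I L (rowOf T)))
      tableaux L = begin
        ⨁ (map (0 ∷_) (hookWords p m)) (loopWeight L)   ≈⟨ ⨁-map (0 ∷_) (hookWords p m) (loopWeight L) ⟩
        ⨁ (hookWords p m) (λ u → loopWeight L (0 ∷ u))  ≈⟨ SYT-words eq (loopWeight L) ⟨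
        ⨁ (SYT shape d) (loopWeight L ∘ rowWord)
          ≈⟨ ⨁-cong (SYT shape d) (λ {T} _ → reflexive (cong pow (inv-cong w I L (letterAt-rowWord T)))) ⟩
        ⨁ (SYT shape d) (λ T → pow (inv w I L (rowOf T)))  ∎

theorem5p5 : (w : AnnularWeb) (I : RadialCut w) (c : List ℕ → ℚ⟨q⟩) →
    IsSchurExpansion (LLT w I) c →
    ∀ k → 1 ≤ k → k ≤ degree w →
    c (hook k (degree w)) ≈
    ([ initialThickness I ]! ⁻¹ *ᶠ
    ∑ (SLD w I) (λ L →
    ∑ (SYT (hook k (degree w)) (degree w)) (λ T →
    q^ inv w I L (rowOf T))))
theorem5p5 w I c expansion (suc p) _ k≤d =
  -- Over the ring of fractions `webLLT` and `schurCoefficient` unfold to `LLT` and `schur`. The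
  -- hook has arm `p = k - 1` and leg `m = degree w - k`.
  ≃⇒≈ (hook-coefficient c (λ a → ≈⇒≃ (expansion a)) p (degree w ℕ.∸ suc p) (ℕ.m+[n∸m]≡n k≤d))
  where
  open Fractions
  open WebLLT fractionField w I ([ initialThickness I ]! ⁻¹) q^_
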